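{- Let $n > 4.6\cdot 10^{13}$ be an integer with $\gcd(n,6)=1$, and let $S=(a_1)(a_2)(a_3)(a_4)$ be a minimal zero-sum sequence of length $4$ over $\mathbb{Z}/n\mathbb{Z}$ such that $\gcd(n,a_i)=1$ for all $i\in\{1,2,3,4\}$. Then $\operatorname{ind}(S)=1$.
   Context: Elements of $G=\mathbb{Z}/n\mathbb{Z}$ are identified with integers in $\{0,1,\dots,n-1\}$; for an integer $y$, $(y)_n$ denotes the least nonnegative representative of $y$ modulo $n$. A sequence $(a_1)\cdots(a_k)$ over $G$ (a multiset of elements, order irrelevant) is zero-sum if $\sum_i a_i\equiv 0 \pmod n$, and minimal zero-sum if it is zero-sum and no proper nonempty subsequence is zero-sum. The index of $S=(a_1)\cdots(a_k)$ is $\operatorname{ind}(S)=\min\left\{\frac{1}{n}\sum_{i=1}^k (g a_i)_n : 1\le g< n,\ \gcd(g,n)=1\right\}$. -}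

module Defs where

open import Data.Nat using (ℕ; zero; suc; _+_; _*_; _<_; _≤_; NonZero)
open import Data.Nat.DivMod using (_%_)
open import Data.Nat.GCD using (gcd)
open import Data.Bool using (Bool; true; false; if_then_else_)
open import Data.Fin using (Fin)
open import Data.List using (List; []; _∷_; filter; map; upTo; foldr; allFin)
open import Data.Nat.ListAction using (sum)
open import Data.Product using (Σ; _×_)
open import Relation.Binary.PropositionalEquality using (_≡_)
open import Relation.Nullary using (¬_)
open import Data.Integer using (+_)
open import Data.Rational.Unnormalised using (ℚᵘ; _/_)

-- A sequence over Z/nZ of length k: a function Fin k → ℕ, each value in {0,…,n-1}
-- (the identification of G with {0,…,n-1}); order is irrelevant for all notions below.
Seq : ℕ → Set
Seq k = Fin k → ℕ

IsSeqOver : (n k : ℕ) → Seq k → Set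
IsSeqOver n k S = (i : Fin k) → S i < n

subSum : (k : ℕ) → Seq k → (Fin k → Bool) → ℕ
subSum k S m = sum (map (λ i → if m i then S i else 0) (allFin k))

ZeroSumMod : (n : ℕ) .{{_ : NonZero n}} → ℕ → Set
ZeroSumMod n s = s % n ≡ 0

IsZeroSum : (n k : ℕ) .{{_ : NonZero n}} → Seq k → Set
IsZeroSum n k S = ZeroSumMod n (subSum k S (λ _ → true))

Nonempty : (k : ℕ) → (Fin k → Bool) → Set
Nonempty k m = Σ (Fin k) (λ i → m i ≡ true)

Proper : (k : ℕ) → (Fin k → Bool) → Set
Proper k m = Σ (Fin k) (λ i → m i ≡ false)

IsMinimalZeroSum : (n k : ℕ) .{{_ : NonZero n}} → Seq k → Set
IsMinimalZeroSum n k S =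
  IsZeroSum n k S ×
  ((m : Fin k → Bool) → Nonempty k m → Proper k m → ¬ ZeroSumMod n (subSum k S m))

multSum : (n k : ℕ) .{{_ : NonZero n}} → ℕ → Seq k → ℕ
multSum n k g S = sum (map (λ i → (g * S i) % n) (allFin k))

units : (n : ℕ) → List ℕ
units n = filter (λ g → gcd g n Data.Nat.≟ 1) (Data.List.drop 1 (upTo n))
  where import Data.Nat

minimumℕ : ℕ → List ℕ → ℕ
minimumℕ d []       = d
minimumℕ d (x ∷ xs) = foldr Data.Nat._⊓_ x xs
  where import Data.Nat

nInd : (n k : ℕ) .{{_ : NonZero n}} → Seq k → ℕ
nInd n k S = minimumℕ 0 (map (λ g → multSum n k g S) (units n))

ind : (n k : ℕ) .{{_ : NonZero n}} → Seq k → ℚᵘ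
ind n k S = (+ nInd n k S) / n

{-# OPTIONS --safe #-}
module Submission where

-- Suppose every unit multiple of S has residues adding up to 2 n.  Put m⁴ ≤ n < (m + 1)⁴.  By the pigeonhole
-- principle some D ≢ 0 makes all D aᵢ congruent to small integers yᵢ with Σ yᵢ = 0; multiply D so that the largest
-- ∣yᵢ∣ is M with m³ / 4 ≤ M ≤ m³ / 2, and normalise so that this entry is a₀ = 1, y₀ = M.  If g and M − g are units,
-- 0 < g < M, and no residue of g aᵢ with aᵢ ≢ 1 lies between 0 and yᵢ, then the residues of g aᵢ and (M − g) aᵢ add
-- up to yᵢ + n, or to yᵢ when aᵢ ≡ 1, so both totals together are at most 3 n < 4 n.  For each i the lattice
-- {(g , z) : z ≡ g aᵢ} shows that either at most a fraction O(1 / m) of all g is excluded, or the excluded points lie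
-- on one line through the origin and are multiples of a prime q ∣ M.  A Legendre sieve by the primes of n and these
-- q, in which p removes one class (p ∣ M) or two, leaves more g than can be excluded because all primes of n are ≥ 5.

-- The Legendre error can be as large as 3 to the number of primes of n, and the density of
-- admissible g as small as a product of factors 1 - 2 / p. Neither is bounded by a constant, so
-- both are compared with powers of m. Relative to the main term the error is at most 64 m² / M,
-- which forbids a short range g < M; the excluded proportion grows like M / n, which forbids a long
-- one. With M of order m³ the error becomes O(1 / m), and the real contest is this: three excluded
-- sets take at most about 6 M / m points, while the sieve promises 60 M / (8 m) before its error,
-- where 8 = 2³ pays for up to three primes q. The primes q answer an obstacle. If aᵢ ≡ 1 / 2 and M
-- is even, every even g can be excluded; counting cannot absorb such a positive proportion, but
-- sieving by 2 costs only a factor 2. Minimality of S enters as aᵢ + aⱼ ≢ 0: in the normalisation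
-- a₀ = 1, an entry aᵢ ≡ -1 would exclude every g.

open import Defs
open import Data.Nat
open import Data.Nat.Properties
open import Data.Nat.DivMod
open import Data.Nat.Divisibility
open import Data.Nat.GCD using (gcd; gcd-greatest; gcd[m,n]∣m; gcd[m,n]∣n; gcd[m,n]≢0; module Bézout)
open import Data.Nat.Coprimality as Coprimality
  using (Coprime; coprime?; coprime-divisor; coprime-Bézout; gcd≡1⇒coprime; coprime⇒gcd≡1)
open import Data.Nat.Primality
open import Data.Nat.Primality.Factorisation using (factorise)
open import Data.Nat.ListAction using (product)
open import Data.Nat.Tactic.RingSolver using (solve-∀)
import Data.Integer as ℤ
import Data.Integer.Properties as ℤ
open import Data.Rational.Unnormalised using (_≃_; *≡*; 1ℚᵘ)
import Data.Rational.Unnormalised as ℚᵘ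
open import Data.Bool using (Bool; true; false; _∧_; _∨_; not; if_then_else_) renaming (_≟_ to _Bool≟_)
open import Data.Bool.Properties using (∧-assoc)
open import Data.Fin using (Fin; zero; suc; toℕ; fromℕ<; combine)
open import Data.Fin.Properties using (pigeonhole; toℕ<n; toℕ-fromℕ<; combine-injective)
open import Data.List using ([]; _∷_; map; foldr; drop; upTo)
open import Data.List.Membership.Propositional using (_∈_)
open import Data.List.Membership.Propositional.Properties using (∈-map⁺; ∈-map⁻; ∈-filter⁺; ∈-filter⁻; ∈-applyUpTo⁺)
open import Data.List.Relation.Unary.All using ([]; _∷_)
open import Data.List.Relation.Unary.Any using (here; there)
open import Data.Product using (∃; _×_; _,_; proj₁; proj₂)
open import Data.Sum using (_⊎_; inj₁; inj₂)
open import Data.Empty using (⊥; ⊥-elim)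
open import Data.Unit using (tt)
open import Function using (_∘_; _$_)
open import Function.Bundles using (mk⇔)
open import Relation.Nullary using (¬_; Dec; yes; no; does; contradiction)
open import Relation.Nullary.Decidable using (dec-true; dec-false; does-⇔; from-no; toWitness; _×-dec_; _⊎-dec_; _→-dec_)
open import Relation.Binary.PropositionalEquality

-- Counting on initial segments of ℕ

indicator : Bool → ℕ
indicator true  = 1
indicator false = 0

count : (ℕ → Bool) → ℕ → ℕ
count P zero    = 0
count P (suc N) = indicator (P N) + count P N

private
  variable
    φ ψ χ : ℕ → Bool

does⇒ : ∀ {A : Set} (d : Dec A) → does d ≡ true → A
does⇒ (yes a) _ = a

∧-elim : ∀ {a b} → a ∧ b ≡ true → a ≡ true × b ≡ true
∧-elim {true} {true} _ = refl , refl

∧-intro : ∀ {a b} → a ≡ true → b ≡ true → a ∧ b ≡ true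
∧-intro refl refl = refl

count-cong : ∀ N → (∀ i → i < N → φ i ≡ ψ i) → count φ N ≡ count ψ N
count-cong zero    h = refl
count-cong (suc N) h = cong₂ _+_ (cong indicator (h N ≤-refl)) (count-cong N λ i i<N → h i (m≤n⇒m≤1+n i<N))

count-mono : ∀ N → (∀ i → i < N → φ i ≡ true → ψ i ≡ true) → count φ N ≤ count ψ N
count-mono zero h = z≤n
count-mono {φ} {ψ} (suc N) h = +-mono-≤ (step (φ N) (ψ N) (h N ≤-refl)) (count-mono N λ i i<N → h i (m≤n⇒m≤1+n i<N))
  where
  step : ∀ a b → (a ≡ true → b ≡ true) → indicator a ≤ indicator b
  step false b     h = z≤n
  step true  true  h = ≤-refl
  step true  false h with () ← h refl

count-∨ : ∀ N → (∀ i → i < N → φ i ≡ true → ψ i ≡ true ⊎ χ i ≡ true) → count φ N ≤ count ψ N + count χ N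
count-∨ zero h = z≤n
count-∨ {φ} {ψ} {χ} (suc N) h = begin
  indicator (φ N) + count φ N ≤⟨ +-mono-≤ (step (φ N) (ψ N) (χ N) (h N ≤-refl)) (count-∨ N λ i i<N → h i (m≤n⇒m≤1+n i<N)) ⟩
  (indicator (ψ N) + indicator (χ N)) + (count ψ N + count χ N) ≡⟨ lem (indicator (ψ N)) _ _ _ ⟩
  (indicator (ψ N) + count ψ N) + (indicator (χ N) + count χ N) ∎
  where
  open ≤-Reasoning
  lem : ∀ a b c d → (a + b) + (c + d) ≡ (a + c) + (b + d)
  lem = solve-∀
  step : ∀ a b c → (a ≡ true → b ≡ true ⊎ c ≡ true) → indicator a ≤ indicator b + indicator c
  step false b c h = z≤n
  step true true c h = s≤s z≤n
  step true false true h = ≤-refl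
  step true false false h with h refl
  ... | inj₁ ()
  ... | inj₂ ()

count-split : ∀ (P Q : ℕ → Bool) N →
  count P N ≡ count (λ i → P i ∧ Q i) N + count (λ i → P i ∧ not (Q i)) N
count-split P Q zero = refl
count-split P Q (suc N) rewrite count-split P Q N with P N | Q N
... | false | _ = refl
... | true | true = refl
... | true | false = sym (+-suc _ _)

count-none : ∀ N → (∀ i → i < N → φ i ≡ true → ⊥) → count φ N ≡ 0
count-none zero h = refl
count-none {φ} (suc N) h with φ N in eq
... | true  = ⊥-elim (h N ≤-refl eq)
... | false = count-none N λ i i<N → h i (m≤n⇒m≤1+n i<N)

count-subsingleton : ∀ N → (∀ i j → i < j → j < N → φ i ≡ true → φ j ≡ true → ⊥) → count φ N ≤ 1
count-subsingleton zero h = z≤n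
count-subsingleton {φ} (suc N) h with φ N in eq
... | true  = s≤s (≤-reflexive (count-none N λ i i<N φi → h i N i<N ≤-refl φi eq))
... | false = count-subsingleton N λ i j i<j j<N → h i j i<j (m≤n⇒m≤1+n j<N)

count-fibres : ∀ (f : ℕ → ℕ) (K B : ℕ) N → (∀ i → i < N → φ i ≡ true → f i < K) →
  (∀ l → count (λ i → φ i ∧ does (f i ≟ l)) N ≤ B) → count φ N ≤ K * B
count-fibres f zero B N h k = ≤-reflexive (count-none N λ i i<N φi → n≮0 (h i i<N φi))
count-fibres {φ} f (suc K) B N h k = begin
  count φ N ≡⟨ count-split φ (λ i → does (f i ≟ K)) N ⟩
  count (λ i → φ i ∧ does (f i ≟ K)) N + count (λ i → φ i ∧ not (does (f i ≟ K))) N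
    ≤⟨ +-mono-≤ (k K) (count-fibres f K B N lt fib) ⟩
  B + K * B ∎
  where
  open ≤-Reasoning
  lt : ∀ i → i < N → (φ i ∧ not (does (f i ≟ K))) ≡ true → f i < K
  lt i i<N p = let φi , q = ∧-elim {φ i} p in ≤∧≢⇒< (s≤s⁻¹ (h i i<N φi)) λ e →
    contradiction (trans (cong not (sym (dec-true (f i ≟ K) e))) q) λ ()
  fib : ∀ l → count (λ i → (φ i ∧ not (does (f i ≟ K))) ∧ does (f i ≟ l)) N ≤ B
  fib l = ≤-trans (count-mono N λ i _ p → let q , r = ∧-elim {φ i ∧ _} p in ∧-intro (proj₁ (∧-elim {φ i} q)) r) (k l)

count-injective : ∀ (f : ℕ → ℕ) (K : ℕ) N → (∀ i → i < N → φ i ≡ true → f i < K) →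
  (∀ i j → i < j → j < N → φ i ≡ true → φ j ≡ true → f i ≡ f j → ⊥) → count φ N ≤ K
count-injective {φ} f K N h inj = subst (count φ N ≤_) (*-identityʳ K) $
  count-fibres f K 1 N h λ l → count-subsingleton N λ i j i<j j<N p q →
    let φi , e = ∧-elim {φ i} p ; φj , e' = ∧-elim {φ j} q in
    inj i j i<j j<N φi φj (trans (does⇒ (f i ≟ l) e) (sym (does⇒ (f j ≟ l) e')))

least : ∀ (P : ℕ → Bool) r → P r ≡ true → ∃ λ s → P s ≡ true × s ≤ r × (∀ t → t < s → P t ≡ true → ⊥)
least P zero Pr = 0 , Pr , z≤n , λ _ ()
least P (suc r) Pr with P 0 in e
... | true = 0 , e , z≤n , λ _ ()
... | false with least (P ∘ suc) r Pr
...   | s , Ps , s≤r , mn = suc s , Ps , s≤s s≤r , λ { zero _ p → absurd (trans (sym e) p) ; (suc t) (s≤s lt) p → mn t lt p }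
  where absurd : false ≡ true → ⊥
        absurd ()

-- Congruences modulo n

coprime-* : ∀ {a b c} → Coprime a c → Coprime b c → Coprime (a * b) c
coprime-* ca cb (d∣ab , d∣c) = cb (coprime-divisor (λ (e∣d , e∣a) → ca (e∣a , ∣-trans e∣d d∣c)) d∣ab , d∣c)

module Mod (n : ℕ) .{{_ : NonZero n}} where
  infix 4 _≋_
  _≋_ : ℕ → ℕ → Set
  a ≋ b = a % n ≡ b % n

  +-cong-≋ : ∀ {a b c d} → a ≋ b → c ≋ d → a + c ≋ b + d
  +-cong-≋ {a} {b} {c} {d} p q = trans (%-distribˡ-+ a c n) (trans (cong₂ (λ x y → (x + y) % n) p q) (sym (%-distribˡ-+ b d n)))

  *-cong-≋ : ∀ {a b c d} → a ≋ b → c ≋ d → a * c ≋ b * d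
  *-cong-≋ {a} {b} {c} {d} p q = trans (%-distribˡ-* a c n) (trans (cong₂ (λ x y → (x * y) % n) p q) (sym (%-distribˡ-* b d n)))

  %-≋ : ∀ a → a % n ≋ a
  %-≋ a = m%n%n≡m%n a n

  n*-≋ : ∀ k → k * n ≋ 0
  n*-≋ k = trans (m*n%n≡0 k n) (sym (m<n⇒m%n≡m (>-nonZero⁻¹ n)))

  ∣⇒≋0 : ∀ {a} → n ∣ a → a ≋ 0
  ∣⇒≋0 (divides q refl) = n*-≋ q

  0%n≡0 : 0 % n ≡ 0
  0%n≡0 = m<n⇒m%n≡m (>-nonZero⁻¹ n)

  ≋0⇒∣ : ∀ {a} → a ≋ 0 → n ∣ a
  ≋0⇒∣ {a} p = m%n≡0⇒n∣m a n (trans p 0%n≡0)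

  +-cancelʳ-≋ : ∀ {a b} c → a + c ≋ b + c → a ≋ b
  +-cancelʳ-≋ {a} {b} c p = trans (lift a) (trans (+-cong-≋ p (refl {x = (c * pred n) % n})) (sym (lift b)))
    where
    lem : ∀ x y z → x + y + y * z ≡ x + y * suc z
    lem = solve-∀
    lift : ∀ x → x ≋ x + c + c * pred n
    lift x = sym (trans (cong (_% n) (trans (lem x c (pred n)) (cong (λ z → x + c * z) (suc-pred n)))) ([m+kn]%n≡m%n x c n))

  <⇒≡ : ∀ {a b} → a < n → b < n → a ≋ b → a ≡ b
  <⇒≡ a<n b<n p = trans (sym (m<n⇒m%n≡m a<n)) (trans p (m<n⇒m%n≡m b<n))

  <⇒%≡ : ∀ {a b} → b < n → a ≋ b → a % n ≡ b
  <⇒%≡ b<n p = trans p (m<n⇒m%n≡m b<n)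

  inverse : ∀ {u} → Coprime u n → ∃ λ v → v * u ≋ 1
  inverse {u} c with coprime-Bézout c
  ... | Bézout.+- x y eq = x , trans (cong (_% n) (sym eq)) ([m+kn]%n≡m%n 1 y n)
  -- Here `1 + x * u ≡ y * n`, so the inverse is -x, written as `x * pred n`.
  ... | Bézout.-+ x y eq = x * pred n , +-cancelʳ-≋ (x * u)
          (trans (cong (_% n) (trans (lem x (pred n) u) (cong (λ z → x * u * z) (suc-pred n))))
          (trans (m*n%n≡0 (x * u) n) (sym (trans (cong (_% n) eq) (m*n%n≡0 y n)))))
    where
    lem : ∀ x z u → x * z * u + x * u ≡ x * u * suc z
    lem = solve-∀

  *-cancelʳ-≋ : ∀ {a b u} → Coprime u n → a * u ≋ b * u → a ≋ b
  *-cancelʳ-≋ {a} {b} {u} c p with inverse c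
  ... | v , vu = trans (go a) (trans (*-cong-≋ p (refl {x = v % n})) (sym (go b)))
    where
    lem : ∀ x u v → x * (v * u) ≡ x * u * v
    lem = solve-∀
    go : ∀ x → x ≋ x * u * v
    go x = trans (cong (_% n) (sym (*-identityʳ x))) (trans (sym (*-cong-≋ (refl {x = x % n}) vu)) (cong (_% n) (lem x u v)))

  coprime-≋ : ∀ {a b} → a ≋ b → Coprime a n → Coprime b n
  coprime-≋ {a} {b} p ca {d} (d∣b , d∣n) = ca (∣n∣m%n⇒∣m d∣n (subst (d ∣_) (sym p) (%-presˡ-∣ d∣b d∣n)) , d∣n)

  coprime-inverse : ∀ {u v} → v * u ≋ 1 → Coprime v n
  coprime-inverse {u} {v} p {d} (d∣v , d∣n) = coprime-≋ (sym p) (λ (x , y) → ∣1⇒≡1 x) (∣m⇒∣m*n u d∣v , d∣n)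

  residue>0 : 1 < n → ∀ {u} → Coprime u n → 0 < u % n
  residue>0 1<n {u} c = n≢0⇒n>0 λ e → <-irrefl (sym (c (m%n≡0⇒n∣m u n e , ∣-refl))) 1<n

-- Lattice points in a box

quotient-≡⇒dist< : ∀ a b r .{{_ : NonZero r}} → a / r ≡ b / r → ∣ a - b ∣ < r
quotient-≡⇒dist< a b r e = subst (_< r) (sym step) (<-≤-trans (s≤s (∣m-n∣≤m⊔n (a % r) (b % r))) (⊔-lub (m%n<n a r) (m%n<n b r)))
  where
  step : ∣ a - b ∣ ≡ ∣ a % r - b % r ∣
  step = trans (cong₂ ∣_-_∣ (trans (m≡m%n+[m/n]*n a r) (trans (+-comm (a % r) _) (cong (λ q → q * r + a % r) e)))
                            (trans (m≡m%n+[m/n]*n b r) (+-comm (b % r) _)))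
               (∣m+n-m+o∣≡∣n-o∣ (b / r * r) (a % r) (b % r))

-- Cells of length `suc (n / k)` are just long enough for k of them to cover all residues, and two
-- residues in one cell differ by at most `n / k`. Both pigeonhole arguments use these cells.
cell< : ∀ {x n k} .{{_ : NonZero k}} → x < n → x / suc (n / k) < k
cell< {x} {n} {k} x<n = m<n*o⇒m/o<n (<-trans x<n (subst (_< k * suc (n / k)) (sym (m≡m%n+[m/n]*n n k))
  (subst (n % k + n / k * k <_) (trans (cong (k +_) (*-comm (n / k) k)) (sym (*-suc k (n / k)))) (+-monoˡ-< (n / k * k) (m%n<n n k)))))

-- The points (u , z u) lie on the parallel lines r z + s w = c + l n; the separation hypothesis bounds the number
-- of points on each line both by M / r + 1 and by Y / s + 1.
line-count : ∀ (P : ℕ → Bool) (z w : ℕ → ℕ) (M Y n r s c : ℕ) .{{_ : NonZero n}} .{{_ : NonZero r}} .{{_ : NonZero s}} →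
  (∀ u → u < M → P u ≡ true → z u < Y × w u ≤ M × (r * z u + s * w u) % n ≡ c) →
  (∀ u v → u < v → v < M → P u ≡ true → P v ≡ true → r * z u + s * w u ≡ r * z v + s * w v →
    r ≤ ∣ u - v ∣ × s ≤ ∣ z u - z v ∣) →
  n ≤ r * Y + s * M → count P M * n ≤ 2 * (2 * (M * Y) + (r * Y + s * M))
line-count P z w M Y n r s c inBox sep n≤T = begin
  N * n ≤⟨ *-monoˡ-≤ n N≤Λk ⟩
  Λ * k * n ≡⟨ eq₁ Λ k n ⟩
  k * (Λ * n) ≤⟨ *-monoʳ-≤ k Λn≤2T ⟩
  k * (2 * T) ≡⟨ eq₂ k r s Y M ⟩
  2 * (Y * (k * r) + M * (k * s)) ≤⟨ *-monoʳ-≤ 2 (+-mono-≤ (*-monoʳ-≤ Y kr≤) (*-monoʳ-≤ M ks≤)) ⟩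
  2 * (Y * (M + r) + M * (Y + s)) ≡⟨ eq₃ Y M r s ⟩
  2 * (2 * (M * Y) + (r * Y + s * M)) ∎
  where
  open ≤-Reasoning
  val = λ u → r * z u + s * w u
  T = r * Y + s * M
  -- The values are at most T and congruent modulo n, so there are at most Λ lines; `n ≤ T` absorbs
  -- the rounding into `Λ * n ≤ 2 * T`.
  Λ = suc (T / n)
  k₁ = suc (M / r)
  k₂ = suc (Y / s)
  -- Taking the minimum lets each summand of T use its own bound: `k * r ≤ M + r` for `r * Y`, and
  -- `k * s ≤ Y + s` for `s * M`.
  k = k₁ ⊓ k₂
  N = count P M
  eq₁ : ∀ Λ k n → Λ * k * n ≡ k * (Λ * n)
  eq₁ = solve-∀
  eq₂ : ∀ k r s Y M → k * (2 * (r * Y + s * M)) ≡ 2 * (Y * (k * r) + M * (k * s))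
  eq₂ = solve-∀
  eq₃ : ∀ Y M r s → 2 * (Y * (M + r) + M * (Y + s)) ≡ 2 * (2 * (M * Y) + (r * Y + s * M))
  eq₃ = solve-∀
  index< : ∀ u → u < M → P u ≡ true → val u / n < Λ
  index< u u<M Pu = let zu , wu , _ = inBox u u<M Pu in
    s≤s (/-monoˡ-≤ n (+-mono-≤ (*-monoʳ-≤ r (<⇒≤ zu)) (*-monoʳ-≤ s wu)))
  val≡ : ∀ u v → u < M → v < M → P u ≡ true → P v ≡ true → val u / n ≡ val v / n → val u ≡ val v
  val≡ u v u<M v<M Pu Pv e = trans (m≡m%n+[m/n]*n (val u) n) (trans (cong₂ (λ x y → x + y * n)
    (trans (proj₂ (proj₂ (inBox u u<M Pu))) (sym (proj₂ (proj₂ (inBox v v<M Pv))))) e) (sym (m≡m%n+[m/n]*n (val v) n)))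
  separated : ∀ l u v → u < v → v < M → (P u ∧ does (val u / n ≟ l)) ≡ true → (P v ∧ does (val v / n ≟ l)) ≡ true →
    r ≤ ∣ u - v ∣ × s ≤ ∣ z u - z v ∣
  separated l u v u<v v<M p q =
    let Pu , e = ∧-elim {P u} p ; Pv , e' = ∧-elim {P v} q in
    sep u v u<v v<M Pu Pv (val≡ u v (<-trans u<v v<M) v<M Pu Pv
      (trans (does⇒ (val u / n ≟ l) e) (sym (does⇒ (val v / n ≟ l) e'))))
  N≤Λk₁ : N ≤ Λ * k₁
  N≤Λk₁ = count-fibres (λ u → val u / n) Λ k₁ M index< λ l →
    count-injective (_/ r) k₁ M (λ u u<M _ → s≤s (/-monoˡ-≤ r (<⇒≤ u<M)))
      λ u v u<v v<M p q e → <⇒≱ (quotient-≡⇒dist< u v r e) (proj₁ (separated l u v u<v v<M p q))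
  N≤Λk₂ : N ≤ Λ * k₂
  N≤Λk₂ = count-fibres (λ u → val u / n) Λ k₂ M index< λ l →
    count-injective (λ u → z u / s) k₂ M
      (λ u u<M p → s≤s (/-monoˡ-≤ s (<⇒≤ (proj₁ (inBox u u<M (proj₁ (∧-elim {P u} p)))))))
      λ u v u<v v<M p q e → <⇒≱ (quotient-≡⇒dist< (z u) (z v) s e) (proj₂ (separated l u v u<v v<M p q))
  N≤Λk : N ≤ Λ * k
  N≤Λk = subst (N ≤_) (sym (*-distribˡ-⊓ Λ k₁ k₂)) (⊓-glb N≤Λk₁ N≤Λk₂)
  Λn≤2T : Λ * n ≤ 2 * T
  Λn≤2T = +-mono-≤ n≤T (≤-trans (m/n*n≤m T n) (≤-reflexive (sym (+-identityʳ T))))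
  kr≤ : k * r ≤ M + r
  kr≤ = ≤-trans (*-monoˡ-≤ r (m⊓n≤m k₁ k₂)) (≤-trans (+-monoʳ-≤ r (m/n*n≤m M r)) (≤-reflexive (+-comm r M)))
  ks≤ : k * s ≤ Y + s
  ks≤ = ≤-trans (*-monoˡ-≤ s (m⊓n≤n k₁ k₂)) (≤-trans (+-monoʳ-≤ s (m/n*n≤m Y s)) (≤-reflexive (+-comm s Y)))

primeDivisor : ∀ n .{{_ : NonZero n}} → n ≢ 1 → ∃ λ p → Prime p × p ∣ n
primeDivisor n n≢1 with factorise n
... | record { factors = [] ; isFactorisation = e } = contradiction e n≢1
... | record { factors = p ∷ ps ; isFactorisation = e ; factorsPrime = pp ∷ _ } = p , pp , subst (p ∣_) (sym e) (m∣m*n (product ps))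

-- Negatives and differences of residues

module Difference (n : ℕ) .{{_ : NonZero n}} where
  open Mod n

  -- The residue class of -b through -1 ≡ n - 1, so that b may be any natural number.
  neg : ℕ → ℕ
  neg b = b * pred n

  +-neg : ∀ b → b + neg b ≋ 0
  +-neg b = trans (cong (_% n) (trans (sym (*-suc b (pred n))) (cong (b *_) (suc-pred n)))) (n*-≋ b)

  diff-≤ : ∀ {b u v} → u ≤ v → (u * b) % n ≤ (v * b) % n → ((v ∸ u) * b) % n ≡ (v * b) % n ∸ (u * b) % n
  diff-≤ {b} {u} {v} u≤v z≤z' = <⇒%≡ (≤-<-trans (m∸n≤m ((v * b) % n) ((u * b) % n)) (m%n<n (v * b) n)) (+-cancelʳ-≋ ((u * b) % n) (begin
    ((v ∸ u) * b + (u * b) % n) % n ≡⟨ +-cong-≋ refl (%-≋ (u * b)) ⟩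
    ((v ∸ u) * b + u * b) % n ≡⟨ cong (_% n) (trans (sym (*-distribʳ-+ b (v ∸ u) u)) (cong (_* b) (m∸n+n≡m u≤v))) ⟩
    (v * b) % n ≡⟨ sym (%-≋ (v * b)) ⟩
    (v * b) % n % n ≡⟨ cong (_% n) (sym (m∸n+n≡m z≤z')) ⟩
    ((v * b) % n ∸ (u * b) % n + (u * b) % n) % n ∎))
    where open ≡-Reasoning

  diff-≥ : ∀ {b u v} → u ≤ v → (v * b) % n ≤ (u * b) % n → ((v ∸ u) * neg b) % n ≡ (u * b) % n ∸ (v * b) % n
  diff-≥ {b} {u} {v} u≤v z≥z' = <⇒%≡ (≤-<-trans (m∸n≤m ((u * b) % n) ((v * b) % n)) (m%n<n (u * b) n)) (+-cancelʳ-≋ ((v * b) % n) (begin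
    ((v ∸ u) * neg b + (v * b) % n) % n ≡⟨ +-cong-≋ refl (%-≋ (v * b)) ⟩
    ((v ∸ u) * neg b + v * b) % n ≡⟨ cong (λ x → ((v ∸ u) * neg b + x * b) % n) (sym (m∸n+n≡m u≤v)) ⟩
    ((v ∸ u) * neg b + (v ∸ u + u) * b) % n ≡⟨ cong (_% n) (lem (v ∸ u) (neg b) u b) ⟩
    ((v ∸ u) * (b + neg b) + u * b) % n ≡⟨ +-cong-≋ (*-cong-≋ (refl {x = (v ∸ u) % n}) (+-neg b)) refl ⟩
    ((v ∸ u) * 0 + u * b) % n ≡⟨ cong (λ x → (x + u * b) % n) (*-zeroʳ (v ∸ u)) ⟩
    (u * b) % n ≡⟨ sym (%-≋ (u * b)) ⟩
    (u * b) % n % n ≡⟨ cong (_% n) (sym (m∸n+n≡m z≥z')) ⟩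
    ((u * b) % n ∸ (v * b) % n + (v * b) % n) % n ∎))
    where
    open ≡-Reasoning
    lem : ∀ d c u b → d * c + (d + u) * b ≡ d * (b + c) + u * b
    lem = solve-∀

  coprime-neg : ∀ {b} → Coprime b n → Coprime (neg b) n
  coprime-neg {b} cb {d} (d∣b' , d∣n) = cb (∣m+n∣m⇒∣n (subst (d ∣_) (+-comm b (neg b)) (∣-trans d∣n (≋0⇒∣ (+-neg b)))) d∣b' , d∣n)

  -- The class of P meets the numbers below 2 n in P and P + n alone. This turns congruences for
  -- sums of two residues into exact values.
  wrap : ∀ {a P} → a ≋ P → P < a → a < n + n → P < n → a ≡ P + n
  wrap {a} {P} e P<a a<2n P<n with a <? n
  ... | yes a<n = contradiction (<⇒≡ a<n P<n e) (≢-sym (<⇒≢ P<a))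
  ... | no a≮n = trans (sym (m∸n+n≡m n≤a)) (cong (_+ n) (<⇒≡ (+-cancelʳ-< n (a ∸ n) n (subst (_< n + n) (sym (m∸n+n≡m n≤a)) a<2n)) P<n
      (trans (sym ([m+n]%n≡m%n (a ∸ n) n)) (trans (cong (_% n) (m∸n+n≡m n≤a)) e))))
    where
    n≤a = ≮⇒≥ a≮n

-- Multipliers excluded by one residue class

module Inside (n m M : ℕ) .{{_ : NonZero n}} (2≤m : 2 ≤ m)
  (m⁴≤n : m * m * (m * m) ≤ n) (n≤2m⁴ : n ≤ 2 * (m * m * (m * m))) (2M≤m³ : 2 * M ≤ m * m * m) where
  open Mod n
  open Difference n

  unit : ℕ → Bool
  unit g = does (coprime? g n)

  inside : ℕ → ℕ → Bool
  inside b g = unit g ∧ does ((g * b) % n <? (M * b) % n)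

  private
    instance
      m≢0 : NonZero m
      m≢0 = >-nonZero (≤-trans (s≤s z≤n) 2≤m)
    k = m * m
    instance
      k≢0 : NonZero k
      k≢0 = m*n≢0 m m
    S = n / k

    k<n : k < n
    k<n = begin-strict
      k <⟨ m<m*n k k (≤-trans 2≤m (m≤m*n m m)) ⟩
      k * k ≤⟨ m⁴≤n ⟩
      n ∎
      where open ≤-Reasoning

    S≤2k : S ≤ 2 * k
    S≤2k = ≤-trans (/-monoˡ-≤ k (≤-trans n≤2m⁴ (≤-reflexive (sym (*-assoc 2 k k))))) (≤-reflexive (m*n/n≡m (2 * k) k))

    M<n : M < n
    M<n = begin-strict
      M ≤⟨ m≤n*m M 2 ⟩
      2 * M ≤⟨ 2M≤m³ ⟩
      k * m <⟨ *-monoʳ-< k (m<m*n m m 2≤m) ⟩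
      k * k ≤⟨ m⁴≤n ⟩
      n ∎
      where open ≤-Reasoning

  -- r b ≡ ± s with s ≤ S. Positivity of r belongs to the definition because the least such r is
  -- taken later.
  Near : ℕ → ℕ → Set
  Near b r = 0 < r × ((r * b) % n ≤ S ⊎ (r * neg b) % n ≤ S)

  near? : ∀ b r → Dec (Near b r)
  near? b r = (0 <? r) ×-dec (((r * b) % n ≤? S) ⊎-dec ((r * neg b) % n ≤? S))

  -- Dirichlet approximation: the k + 1 multiples of b by 0, ..., k fall into k cells, and the
  -- difference of two in one cell is near 0.
  dirichlet : ∀ b → ∃ λ r → r ≤ k × Near b r
  dirichlet b = toℕ j ∸ toℕ i , ≤-trans (m∸n≤m (toℕ j) (toℕ i)) (s≤s⁻¹ (toℕ<n j)) , m<n⇒0<n∸m i<j , near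
    where
    z : ℕ → ℕ
    z u = (u * b) % n
    z/L<k : ∀ u → z u / suc S < k
    z/L<k u = cell< (m%n<n (u * b) n)
    ph = pigeonhole (n<1+n k) λ i → fromℕ< (z/L<k (toℕ i))
    i = proj₁ ph
    j = proj₁ (proj₂ ph)
    i<j = proj₁ (proj₂ (proj₂ ph))
    z/L≡ : z (toℕ i) / suc S ≡ z (toℕ j) / suc S
    z/L≡ = trans (sym (toℕ-fromℕ< (z/L<k (toℕ i)))) (trans (cong toℕ (proj₂ (proj₂ (proj₂ ph)))) (toℕ-fromℕ< (z/L<k (toℕ j))))
    dist≤S : ∣ z (toℕ i) - z (toℕ j) ∣ ≤ S
    dist≤S = s≤s⁻¹ (quotient-≡⇒dist< (z (toℕ i)) (z (toℕ j)) (suc S) z/L≡)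
    near : ((toℕ j ∸ toℕ i) * b) % n ≤ S ⊎ ((toℕ j ∸ toℕ i) * neg b) % n ≤ S
    near with ≤-total (z (toℕ i)) (z (toℕ j))
    ... | inj₁ le = inj₁ (subst (_≤ S) (trans (m≤n⇒∣m-n∣≡n∸m le) (sym (diff-≤ {b} (<⇒≤ i<j) le))) dist≤S)
    ... | inj₂ ge = inj₂ (subst (_≤ S) (trans (m≤n⇒∣n-m∣≡n∸m ge) (sym (diff-≥ {b} (<⇒≤ i<j) ge))) dist≤S)

  -- A proportion of 2 (m + 3) / m², about 2 / m, of all g < M.
  Sparse : (ℕ → Bool) → Set
  Sparse P = count P M * (m * m) ≤ 2 * M * (m + 3)

  sparse-none : ∀ {P} → (∀ g → g < M → P g ≡ true → ⊥) → Sparse P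
  sparse-none h = subst (λ c → c * k ≤ 2 * M * (m + 3)) (sym (count-none M h)) z≤n

  -- In m + 3 the m is the area term, from 2 M ≤ m³, and the 3 is the boundary term, from r ≤ m² and
  -- s ≤ 2 m²; n ≥ m⁴ is divided out.
  sparse-box : ∀ P {Y r s} → Y ≤ M → r ≤ k → s ≤ S → count P M * n ≤ 2 * (2 * (M * Y) + (r * Y + s * M)) → Sparse P
  sparse-box P {Y} {r} {s} Y≤M r≤k s≤S h = *-cancelʳ-≤ _ _ k (begin
    count P M * k * k ≡⟨ *-assoc (count P M) k k ⟩
    count P M * (k * k) ≤⟨ *-monoʳ-≤ (count P M) m⁴≤n ⟩
    count P M * n ≤⟨ h ⟩
    2 * (2 * (M * Y) + (r * Y + s * M)) ≤⟨ *-monoʳ-≤ 2 (+-mono-≤ (*-monoʳ-≤ 2 (*-monoʳ-≤ M Y≤M))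
      (+-mono-≤ (*-mono-≤ r≤k Y≤M) (*-monoˡ-≤ M (≤-trans s≤S S≤2k)))) ⟩
    2 * (2 * (M * M) + (k * M + 2 * k * M)) ≡⟨ eq₁ M k ⟩
    2 * M * (2 * M + 3 * k) ≤⟨ *-monoʳ-≤ (2 * M) (+-monoˡ-≤ (3 * k) 2M≤m³) ⟩
    2 * M * (k * m + 3 * k) ≡⟨ eq₂ M k m ⟩
    2 * M * (m + 3) * k ∎)
    where
    open ≤-Reasoning
    eq₁ : ∀ M k → 2 * (2 * (M * M) + (k * M + 2 * k * M)) ≡ 2 * M * (2 * M + 3 * k)
    eq₁ = solve-∀
    eq₂ : ∀ M k m → 2 * M * (k * m + 3 * k) ≡ 2 * M * (m + 3) * k
    eq₂ = solve-∀

  inside-elim : ∀ b g → inside b g ≡ true → Coprime g n × (g * b) % n < (M * b) % n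
  inside-elim b g p = let q , r = ∧-elim {unit g} p in does⇒ (coprime? g n) q , does⇒ (_ <? _) r

  -- Points (g , z) with r z ≡ s g exactly: z = s' g / r' in lowest terms, and r' = 1 only for the diagonal.
  inside-collinear : ∀ b → Coprime b n → ¬ (b ≋ 1) → ∀ r s → 0 < r → 0 < s → (r * b) % n ≡ s →
    r * ((M * b) % n) + s * M < n → (M * b) % n ≤ M →
    Sparse (inside b) ⊎ ∃ λ q → Prime q × q ∣ M × (∀ g → g < M → inside b g ≡ true → q ∣ g)
  inside-collinear b cb b≢1 r s 0<r 0<s rb≡s T<n Y≤M with M ≟ 0 | r ≟ s
  ... | yes M≡0 | _ = inj₁ (sparse-none λ g g<M _ → n≮0 (subst (g <_) M≡0 g<M))
  ... | no M≢0 | r≟s = cases r≟s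
    where
    Y = (M * b) % n
    z : ℕ → ℕ
    z g = (g * b) % n
    onLine : ∀ g → g ≤ M → z g ≤ Y → r * z g ≡ s * g
    onLine g g≤M z≤Y = <⇒≡ (≤-<-trans (≤-trans (*-monoʳ-≤ r z≤Y) (m≤m+n (r * Y) (s * M))) T<n)
                            (≤-<-trans (≤-trans (*-monoʳ-≤ s g≤M) (m≤n+m (s * M) (r * Y))) T<n) (begin
      (r * z g) % n ≡⟨ *-cong-≋ (refl {x = r % n}) (%-≋ (g * b)) ⟩
      (r * (g * b)) % n ≡⟨ cong (_% n) (lem r g b) ⟩
      (r * b * g) % n ≡⟨ *-cong-≋ (sym (%-≋ (r * b))) (refl {x = g % n}) ⟩
      ((r * b) % n * g) % n ≡⟨ cong (λ x → (x * g) % n) rb≡s ⟩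
      (s * g) % n ∎)
      where
      open ≡-Reasoning
      lem : ∀ r g b → r * (g * b) ≡ r * b * g
      lem = solve-∀
    cases : Dec (r ≡ s) → _
    cases (yes refl) = inj₁ (sparse-none λ g g<M p → let cg , z<Y = inside-elim b g p in
      b≢1 (*-cancelʳ-≋ cg (trans (cong (_% n) (*-comm b g)) (trans (sym (%-≋ (g * b)))
        (cong (_% n) (trans (*-cancelˡ-≡ (z g) g r {{>-nonZero 0<r}} (onLine g (<⇒≤ g<M) (<⇒≤ z<Y))) (sym (*-identityˡ g))))))))
    cases (no r≢s) = inj₂ (q , prime-q , q∣ M (onLine M ≤-refl ≤-refl) ,
        λ g g<M p → q∣ g (onLine g (<⇒≤ g<M) (<⇒≤ (proj₂ (inside-elim b g p)))))
      where
      -- The endpoint `(M , Y)` lies on the same line, `r * Y ≡ s * M`, and `Y ≤ M` then bounds the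
      -- slope by 1.
      s<r : s < r
      s<r = ≤∧≢⇒< (*-cancelʳ-≤ s r M {{≢-nonZero M≢0}} (subst (_≤ r * M) (onLine M ≤-refl ≤-refl) (*-monoʳ-≤ r Y≤M))) (≢-sym r≢s)
      d = gcd r s
      instance
        d≢0 : NonZero d
        d≢0 = ≢-nonZero (gcd[m,n]≢0 r s (inj₁ λ r≡0 → <-irrefl (sym r≡0) 0<r))
      r' = r / d
      s' = s / d
      r'd : r ≡ r' * d
      r'd = sym (m/n*n≡m (gcd[m,n]∣m r s))
      s'd : s ≡ s' * d
      s'd = sym (m/n*n≡m (gcd[m,n]∣n r s))
      r'≢0 : NonZero r'
      r'≢0 = ≢-nonZero λ e → <-irrefl (sym (trans r'd (cong (_* d) e))) 0<r
      r'≢1 : r' ≢ 1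
      r'≢1 e = <⇒≱ s<r (∣⇒≤ {{>-nonZero 0<s}} (subst (_∣ s) (sym (trans r'd (trans (cong (_* d) e) (*-identityˡ d)))) (gcd[m,n]∣n r s)))
      pd = primeDivisor r' {{r'≢0}} r'≢1
      q = proj₁ pd
      prime-q = proj₁ (proj₂ pd)
      q∣ : ∀ g → r * z g ≡ s * g → q ∣ g
      q∣ g eq = ∣-trans (proj₂ (proj₂ pd)) (coprime-divisor (Coprimality.coprime-/gcd r s)
        (divides (z g) (*-cancelʳ-≡ (s' * g) (z g * r') d (begin
          s' * g * d ≡⟨ lem s' g d ⟩
          s' * d * g ≡⟨ cong (_* g) (sym s'd) ⟩
          s * g ≡⟨ sym eq ⟩
          r * z g ≡⟨ cong (_* z g) r'd ⟩
          r' * d * z g ≡⟨ lem' r' d (z g) ⟩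
          z g * r' * d ∎))))
        where
        open ≡-Reasoning
        lem : ∀ s' g d → s' * g * d ≡ s' * d * g
        lem = solve-∀
        lem' : ∀ r' d z → r' * d * z ≡ z * r' * d
        lem' = solve-∀

  1<n : 1 < n
  1<n = ≤-<-trans (>-nonZero⁻¹ k) k<n

  module Minimal (b : ℕ) (cb : Coprime b n) (b≢1 : ¬ (b ≋ 1)) (Y≤M : (M * b) % n ≤ M)
    (r : ℕ) (0<r : 0 < r) (r≤k : r ≤ k) (minimal : ∀ t → t < r → Near b t → ⊥) where
    private
      Y = (M * b) % n
      z : ℕ → ℕ
      z g = (g * b) % n
      instance
        r≢0 : NonZero r
        r≢0 = >-nonZero 0<r

    residue≢0 : ∀ c → Coprime c n → 0 < (r * c) % n
    residue≢0 c cc = n≢0⇒n>0 λ s≡0 → <⇒≱ (≤-<-trans r≤k k<n)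
      (∣⇒≤ (coprime-divisor (Coprimality.sym cc) (subst (n ∣_) (*-comm r c) (m%n≡0⇒n∣m (r * c) n s≡0))))

    -- `(ρ , δ)` is the difference of two points on one line. If ρ were below r, then δ would be
    -- below s by proportionality, and ρ would be a smaller near multiplier; the last hypothesis
    -- receives this contradiction with the minimality of r.
    separation : ∀ {s} ρ δ → 0 < s → r * δ ≡ s * ρ → (ρ < r → δ < s → ⊥) → r ≤ ρ × s ≤ δ
    separation {s} ρ δ 0<s e h = r≤ρ , *-cancelˡ-≤ r (subst (_≤ r * δ) (*-comm s r) (subst (s * r ≤_) (sym e) (*-monoʳ-≤ s r≤ρ)))
      where
      r≤ρ : r ≤ ρ
      r≤ρ = ≮⇒≥ λ ρ<r → h ρ<r (*-cancelˡ-< r δ s (subst (r * δ <_) (*-comm s r) (subst (_< s * r) (sym e) (*-monoʳ-< s {{>-nonZero 0<s}} ρ<r))))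

    -- The size of `r * Y + s * M` decides. From n on, several parallel lines can meet the box and
    -- `line-count` applies; below n the congruence r z ≡ s g is an equality, and all points lie on
    -- one line through the origin.
    forward : (r * b) % n ≤ S → Sparse (inside b) ⊎ ∃ λ q → Prime q × q ∣ M × (∀ g → g < M → inside b g ≡ true → q ∣ g)
    forward s≤S with n ≤? r * Y + (r * b) % n * M
    ... | no T<n = inside-collinear b cb b≢1 r _ 0<r (residue≢0 b cb) refl (≰⇒> T<n) Y≤M
    ... | yes n≤T = inj₁ (sparse-box (inside b) Y≤M r≤k s≤S
            -- The reflected coordinate M - u removes the minus sign of r z - s u ≡ 0, which becomes
            -- r z + s (M - u) ≡ s M.
            (line-count (inside b) z (M ∸_) M Y n r s ((s * M) % n)
              (λ u u<M p → proj₂ (inside-elim b u p) , m∸n≤m M u , onLine u u<M) sep n≤T))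
      where
      s = (r * b) % n
      instance
        s≢0 : NonZero s
        s≢0 = >-nonZero (residue≢0 b cb)
      onLine : ∀ u → u < M → (r * z u + s * (M ∸ u)) % n ≡ (s * M) % n
      onLine u u<M = +-cancelʳ-≋ (s * u) (begin
        (r * z u + s * (M ∸ u) + s * u) % n ≡⟨ cong (_% n) (trans (eq₁ (r * z u) s (M ∸ u) u) (cong (λ x → r * z u + s * x) (m∸n+n≡m (<⇒≤ u<M)))) ⟩
        (r * z u + s * M) % n ≡⟨ +-cong-≋ (trans (*-cong-≋ (refl {x = r % n}) (%-≋ (u * b))) (trans (cong (_% n) (eq₂ r u b)) (*-cong-≋ (sym (%-≋ (r * b))) (refl {x = u % n})))) (refl {x = (s * M) % n}) ⟩
        (s * u + s * M) % n ≡⟨ cong (_% n) (+-comm (s * u) (s * M)) ⟩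
        (s * M + s * u) % n ∎)
        where
        open ≡-Reasoning
        eq₁ : ∀ a s x u → a + s * x + s * u ≡ a + s * (x + u)
        eq₁ = solve-∀
        eq₂ : ∀ r u b → r * (u * b) ≡ r * b * u
        eq₂ = solve-∀
      sep : ∀ u v → u < v → v < M → inside b u ≡ true → inside b v ≡ true →
        r * z u + s * (M ∸ u) ≡ r * z v + s * (M ∸ v) → r ≤ ∣ u - v ∣ × s ≤ ∣ z u - z v ∣
      sep u v u<v v<M _ _ e = subst₂ (λ x y → r ≤ x × s ≤ y) (sym (m≤n⇒∣m-n∣≡n∸m (<⇒≤ u<v))) (sym (m≤n⇒∣m-n∣≡n∸m zu≤zv)) $ separation (v ∸ u) (z v ∸ z u) (residue≢0 b cb) e₂
          λ ρ<r δ<s → minimal (v ∸ u) ρ<r (m<n⇒0<n∸m u<v , inj₁ (subst (_≤ S) (sym (diff-≤ {b} (<⇒≤ u<v) zu≤zv)) (≤-trans (<⇒≤ δ<s) s≤S)))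
        where
        e₁ : r * z u + s * (v ∸ u) ≡ r * z v
        e₁ = +-cancelʳ-≡ (s * (M ∸ v)) _ _ (trans (eq (r * z u) s (v ∸ u) (M ∸ v)) (trans (cong (λ x → r * z u + s * x)
               (trans (+-comm (v ∸ u) (M ∸ v)) (trans (sym (+-∸-assoc (M ∸ v) (<⇒≤ u<v))) (cong (_∸ u) (m∸n+n≡m (<⇒≤ v<M)))))) e))
          where
          eq : ∀ a s x y → a + s * x + s * y ≡ a + s * (x + y)
          eq = solve-∀
        zu≤zv : z u ≤ z v
        zu≤zv = *-cancelˡ-≤ r (subst (r * z u ≤_) e₁ (m≤m+n (r * z u) (s * (v ∸ u))))
        e₂ : r * (z v ∸ z u) ≡ s * (v ∸ u)
        e₂ = trans (*-distribˡ-∸ r (z v) (z u)) (trans (cong (_∸ r * z u) (sym e₁)) (m+n∸m≡n (r * z u) _))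

    onLine⁻ : ∀ u → r * z u + (r * neg b) % n * u ≋ 0
    onLine⁻ u = begin
      (r * z u + (r * neg b) % n * u) % n ≡⟨ +-cong-≋ (*-cong-≋ (refl {x = r % n}) (%-≋ (u * b))) (*-cong-≋ (%-≋ (r * neg b)) (refl {x = u % n})) ⟩
      (r * (u * b) + r * neg b * u) % n ≡⟨ cong (_% n) (eq r u b (neg b)) ⟩
      (r * u * (b + neg b)) % n ≡⟨ *-cong-≋ (refl {x = (r * u) % n}) (+-neg b) ⟩
      (r * u * 0) % n ≡⟨ cong (_% n) (*-zeroʳ (r * u)) ⟩
      0 % n ∎
      where
      open ≡-Reasoning
      eq : ∀ r u b c → r * (u * b) + r * c * u ≡ r * u * (b + c)
      eq = solve-∀

    -- The lines now have negative slope, r z + s g ≡ 0. If the box stays below the value n, the sum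
    -- would have to be 0 although r z is positive, so no point is left and no exceptional prime
    -- arises.
    backward : (r * neg b) % n ≤ S → Sparse (inside b)
    backward s≤S with n ≤? r * Y + (r * neg b) % n * M
    ... | no T<n = sparse-none λ g g<M p → let cg , z<Y = inside-elim b g p in
            <⇒≢ (<-≤-trans (*-mono-< 0<r (residue>0 1<n (coprime-* cg cb))) (m≤m+n (r * z g) _)) (sym (<⇒≡ (≤-<-trans
              (+-mono-≤ (*-monoʳ-≤ r (<⇒≤ z<Y)) (*-monoʳ-≤ ((r * neg b) % n) (<⇒≤ g<M))) (≰⇒> T<n)) (≤-<-trans z≤n 1<n) (onLine⁻ g)))
    ... | yes n≤T = sparse-box (inside b) Y≤M r≤k s≤S
            (line-count (inside b) z (λ u → u) M Y n r s (0 % n)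
              (λ u u<M p → proj₂ (inside-elim b u p) , <⇒≤ u<M , onLine⁻ u) sep n≤T)
      where
      s = (r * neg b) % n
      0<s : 0 < s
      0<s = residue≢0 (neg b) (coprime-neg cb)
      instance
        s≢0 : NonZero s
        s≢0 = >-nonZero 0<s
      sep : ∀ u v → u < v → v < M → inside b u ≡ true → inside b v ≡ true →
        r * z u + s * u ≡ r * z v + s * v → r ≤ ∣ u - v ∣ × s ≤ ∣ z u - z v ∣
      sep u v u<v v<M _ _ e = subst₂ (λ x y → r ≤ x × s ≤ y) (sym (m≤n⇒∣m-n∣≡n∸m (<⇒≤ u<v))) (sym (m≤n⇒∣n-m∣≡n∸m zv≤zu)) $ separation (v ∸ u) (z u ∸ z v) 0<s e₂
          λ ρ<r δ<s → minimal (v ∸ u) ρ<r (m<n⇒0<n∸m u<v , inj₂ (subst (_≤ S) (sym (diff-≥ {b} (<⇒≤ u<v) zv≤zu)) (≤-trans (<⇒≤ δ<s) s≤S)))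
        where
        e₁ : r * z u ≡ r * z v + s * (v ∸ u)
        e₁ = +-cancelʳ-≡ (s * u) _ _ (trans e (trans (cong (λ x → r * z v + s * x) (sym (m∸n+n≡m (<⇒≤ u<v)))) (eq (r * z v) s (v ∸ u) u)))
          where
          eq : ∀ a s x y → a + s * (x + y) ≡ a + s * x + s * y
          eq = solve-∀
        zv≤zu : z v ≤ z u
        zv≤zu = *-cancelˡ-≤ r (subst (r * z v ≤_) (sym e₁) (m≤m+n (r * z v) (s * (v ∸ u))))
        e₂ : r * (z u ∸ z v) ≡ s * (v ∸ u)
        e₂ = trans (*-distribˡ-∸ r (z u) (z v)) (trans (cong (_∸ r * z v) e₁) (m+n∸m≡n (r * z v) _))

  inside-sparse : ∀ b → Coprime b n → ¬ (b ≋ 1) → (M * b) % n ≤ M →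
    Sparse (inside b) ⊎ ∃ λ q → Prime q × q ∣ M × (∀ g → g < M → inside b g ≡ true → q ∣ g)
  inside-sparse b cb b≢1 Y≤M with dirichlet b
  ... | r₀ , r₀≤k , near₀ with least (λ r → does (near? b r)) r₀ (dec-true (near? b r₀) near₀)
  ...   | r , near-r , r≤r₀ , minimal with does⇒ (near? b r) near-r
  ...     | 0<r , inj₁ s≤S = Minimal.forward b cb b≢1 Y≤M r 0<r (≤-trans r≤r₀ r₀≤k) (λ t t<r nt → minimal t t<r (dec-true (near? b t) nt)) s≤S
  ...     | 0<r , inj₂ s≤S = inj₁ (Minimal.backward b cb b≢1 Y≤M r 0<r (≤-trans r≤r₀ r₀≤k) (λ t t<r nt → minimal t t<r (dec-true (near? b t) nt)) s≤S)

-- The sieve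

progression : (ℕ → Bool) → ℕ → ℕ → ℕ → Bool
progression f x Q h = f (x + Q * h)

-- N' is the number of members of the class below N. The two inequalities determine it without
-- division, and in the induction it moves exactly when N itself lies in the class.
count-residue : ∀ (f : ℕ → Bool) p .{{_ : NonZero p}} h₀ → h₀ < p → ∀ N → ∃ λ N' →
  N ≤ h₀ + p * N' × h₀ + p * N' < N + p ×
  count (λ h → f h ∧ does (h % p ≟ h₀)) N ≡ count (progression f h₀ p) N'
count-residue f p h₀ h₀<p zero = 0 , z≤n , subst (_< p) (sym (trans (cong (h₀ +_) (*-zeroʳ p)) (+-identityʳ h₀))) h₀<p , refl
count-residue f p h₀ h₀<p (suc N) with count-residue f p h₀ h₀<p N
... | N' , lo , hi , eq with N ≟ h₀ + p * N'
...   | yes N≡ = suc N' , ≤-trans (≤-reflexive (cong suc N≡)) (subst (suc (h₀ + p * N') ≤_) (sym step) (m<m+n _ (>-nonZero⁻¹ p)))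
        , s≤s (≤-reflexive (trans step (cong (_+ p) (sym N≡)))) , cong₂ _+_ (cong indicator new) eq
  where
  step : h₀ + p * suc N' ≡ h₀ + p * N' + p
  step = trans (cong (h₀ +_) (trans (*-suc p N') (+-comm p _))) (sym (+-assoc h₀ _ p))
  N%p : N % p ≡ h₀
  N%p = trans (cong (_% p) (trans N≡ (cong (h₀ +_) (*-comm p N')))) (trans ([m+kn]%n≡m%n h₀ N' p) (m<n⇒m%n≡m h₀<p))
  new : (f N ∧ does (N % p ≟ h₀)) ≡ f (h₀ + p * N')
  new rewrite dec-true (N % p ≟ h₀) N%p | sym N≡ with f N
  ... | true = refl
  ... | false = refl
...   | no N≢ = N' , ≤∧≢⇒< lo N≢ , m<n⇒m<1+n hi , trans (cong (λ b → indicator b + count (λ h → f h ∧ does (h % p ≟ h₀)) N) new) eq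
  where
  N%p≢ : N % p ≢ h₀
  N%p≢ e = N≢ (trans N≡ (cong (λ q → h₀ + p * q) (≤-antisym
      (*-cancelˡ-≤ p (+-cancelˡ-≤ h₀ _ _ (subst (_≤ h₀ + p * N') N≡ lo)))
      (s≤s⁻¹ (*-cancelˡ-< p N' (suc (N / p)) (+-cancelˡ-< h₀ _ _ (subst (h₀ + p * N' <_)
         (trans (cong (_+ p) N≡) (trans (+-assoc h₀ _ p) (cong (h₀ +_) (trans (+-comm _ p) (sym (*-suc p (N / p))))))) hi)))))))
    where
    N≡ : N ≡ h₀ + p * (N / p)
    N≡ = trans (m≡m%n+[m/n]*n N p) (cong₂ _+_ e (*-comm (N / p) p))
  new : (f N ∧ does (N % p ≟ h₀)) ≡ false
  new rewrite dec-false (N % p ≟ h₀) N%p≢ with f N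
  ... | true = refl
  ... | false = refl

-- The root is Q⁻¹ (c - x) modulo p.
residueRoot : ∀ p .{{_ : NonZero p}} x Q c → Coprime Q p → ∃ λ h₀ → h₀ < p ×
  (∀ h → ((x + Q * h) % p ≡ c % p → h % p ≡ h₀) × (h % p ≡ h₀ → (x + Q * h) % p ≡ c % p))
residueRoot p x Q c cQ = h₀ , m%n<n h₁ p , λ h →
    (λ e → *-cancelʳ-≋ cQ (trans (cong (_% p) (*-comm h Q)) (trans (+-cancelʳ-≋ x (trans (cong (_% p) (+-comm (Q * h) x))
      (trans e (trans (sym root) (cong (_% p) (+-comm x (Q * h₁))))))) (cong (_% p) (*-comm Q h₁)))))
  , λ e → trans (+-cong-≋ (refl {x = x % p}) (*-cong-≋ (refl {x = Q % p}) e)) root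
  where
  open Mod p
  open Difference p
  v = proj₁ (inverse cQ)
  h₁ = v * (c + neg x)
  h₀ = h₁ % p
  eq : ∀ x Q v c n → x + Q * (v * (c + n)) ≡ x + v * Q * (c + n)
  eq = solve-∀
  eq' : ∀ x c n → x + 1 * (c + n) ≡ c + (x + n)
  eq' = solve-∀
  root : (x + Q * h₁) % p ≡ c % p
  root = begin
    (x + Q * h₁) % p ≡⟨ cong (_% p) (eq x Q v c (neg x)) ⟩
    (x + v * Q * (c + neg x)) % p ≡⟨ +-cong-≋ (refl {x = x % p}) (*-cong-≋ (proj₂ (inverse cQ)) (refl {x = (c + neg x) % p})) ⟩
    (x + 1 * (c + neg x)) % p ≡⟨ cong (_% p) (eq' x c (neg x)) ⟩
    (c + (x + neg x)) % p ≡⟨ +-cong-≋ (refl {x = c % p}) (+-neg x) ⟩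
    (c + 0) % p ≡⟨ cong (_% p) (+-identityʳ c) ⟩
    c % p ∎
    where open ≡-Reasoning

-- f has density Π / W, with discrepancy at most E, in every progression whose difference is coprime to W.
Density : (ℕ → Bool) → ℕ → ℕ → ℕ → Set
Density f Π W E = ∀ x Q N → Coprime Q W →
  W * count (progression f x Q) N ≤ N * Π + E * W × N * Π ≤ W * count (progression f x Q) N + E * W

prime-coprime : ∀ {p} k → Prime p → ¬ p ∣ k → Coprime p k
prime-coprime {p} k pp p∤k {d} (d∣p , d∣k) with prime⇒irreducible pp d∣p
... | inj₁ d≡1 = d≡1
... | inj₂ refl = contradiction d∣k p∤k

module Residue {f Π W E} (dens : Density f Π W E) (Π≤W : Π ≤ W) (p : ℕ) .{{_ : NonZero p}} (cp : Coprime p W) where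
  -- Writing h = h₀ + p h' turns the class into a progression of difference `Q * p`, still coprime
  -- to W; the induction works because `Density` speaks of all such progressions. Replacing N / p by
  -- an integer shifts the main term by at most `p * Π ≤ p * W`, which is the additional unit in
  -- `suc E`.
  density-residue : ∀ x Q N c → Coprime Q W → Coprime Q p →
    p * W * count (λ h → progression f x Q h ∧ does ((x + Q * h) % p ≟ c % p)) N ≤ N * Π + suc E * (p * W) ×
    N * Π ≤ p * W * count (λ h → progression f x Q h ∧ does ((x + Q * h) % p ≟ c % p)) N + suc E * (p * W)
  density-residue x Q N c cQW cQp = from-root (residueRoot p x Q c cQp)
    where
    C = count (λ h → progression f x Q h ∧ does ((x + Q * h) % p ≟ c % p)) N
    from-root : (∃ λ h₀ → h₀ < p × (∀ h → ((x + Q * h) % p ≡ c % p → h % p ≡ h₀) × (h % p ≡ h₀ → (x + Q * h) % p ≡ c % p))) →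
      p * W * C ≤ N * Π + suc E * (p * W) × N * Π ≤ p * W * C + suc E * (p * W)
    from-root (h₀ , h₀<p , root) = from-count (count-residue (progression f x Q) p h₀ h₀<p N)
      where
      from-count : (∃ λ N' → N ≤ h₀ + p * N' × h₀ + p * N' < N + p ×
          count (λ h → progression f x Q h ∧ does (h % p ≟ h₀)) N ≡ count (progression (progression f x Q) h₀ p) N') →
        p * W * C ≤ N * Π + suc E * (p * W) × N * Π ≤ p * W * C + suc E * (p * W)
      from-count (N' , lo , hi , eq) = upper , lower
        where
        open ≤-Reasoning
        C' = count (progression f (x + Q * h₀) (Q * p)) N'
        C≡C' : C ≡ C'
        C≡C' = trans (count-cong N λ h _ → cong (progression f x Q h ∧_)
                       (does-⇔ (mk⇔ (proj₁ (root h)) (proj₂ (root h))) ((x + Q * h) % p ≟ c % p) (h % p ≟ h₀)))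
               (trans eq (count-cong N' λ h _ → cong f (lem x Q h₀ p h)))
          where
          lem : ∀ x Q h₀ p h → x + Q * (h₀ + p * h) ≡ x + Q * h₀ + Q * p * h
          lem = solve-∀
        ih = dens (x + Q * h₀) (Q * p) N' (coprime-* cQW cp)
        hi' : p * N' ≤ N + p
        hi' = ≤-trans (m≤n+m (p * N') h₀) (<⇒≤ hi)
        lo' : N ≤ p * N' + p
        lo' = ≤-trans lo (≤-trans (+-monoˡ-≤ (p * N') (<⇒≤ h₀<p)) (≤-reflexive (+-comm p (p * N'))))
        upper : p * W * C ≤ N * Π + suc E * (p * W)
        upper rewrite C≡C' = begin
          p * W * C' ≡⟨ *-assoc p W C' ⟩
          p * (W * C') ≤⟨ *-monoʳ-≤ p (proj₁ ih) ⟩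
          p * (N' * Π + E * W) ≡⟨ e₁ p N' Π E W ⟩
          p * N' * Π + E * (p * W) ≤⟨ +-monoˡ-≤ (E * (p * W)) (*-monoˡ-≤ Π hi') ⟩
          (N + p) * Π + E * (p * W) ≡⟨ e₂ N p Π E W ⟩
          N * Π + (p * Π + E * (p * W)) ≤⟨ +-monoʳ-≤ (N * Π) (+-monoˡ-≤ (E * (p * W)) (*-monoʳ-≤ p Π≤W)) ⟩
          N * Π + suc E * (p * W) ∎
          where
          e₁ : ∀ p N' Π E W → p * (N' * Π + E * W) ≡ p * N' * Π + E * (p * W)
          e₁ = solve-∀
          e₂ : ∀ N p Π E W → (N + p) * Π + E * (p * W) ≡ N * Π + (p * Π + E * (p * W))
          e₂ = solve-∀
        lower : N * Π ≤ p * W * C + suc E * (p * W)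
        lower rewrite C≡C' = begin
          N * Π ≤⟨ *-monoˡ-≤ Π lo' ⟩
          (p * N' + p) * Π ≡⟨ e₁ p N' Π ⟩
          p * (N' * Π + Π) ≤⟨ *-monoʳ-≤ p (+-mono-≤ (proj₂ ih) Π≤W) ⟩
          p * (W * C' + E * W + W) ≡⟨ e₂ p W C' E ⟩
          p * W * C' + suc E * (p * W) ∎
          where
          e₁ : ∀ p N' Π → (p * N' + p) * Π ≡ p * (N' * Π + Π)
          e₁ = solve-∀
          e₂ : ∀ p W C' E → p * (W * C' + E * W + W) ≡ p * W * C' + suc E * (p * W)
          e₂ = solve-∀

module Distance (p : ℕ) .{{_ : NonZero p}} where
  open Mod p

  ∣∸⇒≋ : ∀ {a b} → a ≤ b → p ∣ b ∸ a → a ≋ b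
  ∣∸⇒≋ {a} {b} a≤b d = trans (sym (+-cong-≋ (∣⇒≋0 d) (refl {x = a % p}))) (cong (_% p) (m∸n+n≡m a≤b))

  ≋⇒∣∸ : ∀ {a b} → a ≤ b → a ≋ b → p ∣ b ∸ a
  ≋⇒∣∸ {a} {b} a≤b e = ≋0⇒∣ (+-cancelʳ-≋ a (trans (cong (_% p) (m∸n+n≡m a≤b)) (sym e)))

  ∣dist⇒≋ : ∀ a b → p ∣ ∣ a - b ∣ → a ≋ b
  ∣dist⇒≋ a b d with ≤-total a b
  ... | inj₁ a≤b = ∣∸⇒≋ a≤b (subst (p ∣_) (m≤n⇒∣m-n∣≡n∸m a≤b) d)
  ... | inj₂ b≤a = sym (∣∸⇒≋ b≤a (subst (p ∣_) (m≤n⇒∣n-m∣≡n∸m b≤a) d))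

  ≋⇒∣dist : ∀ a b → a ≋ b → p ∣ ∣ a - b ∣
  ≋⇒∣dist a b e with ≤-total a b
  ... | inj₁ a≤b = subst (p ∣_) (sym (m≤n⇒∣m-n∣≡n∸m a≤b)) (≋⇒∣∸ a≤b e)
  ... | inj₂ b≤a = subst (p ∣_) (sym (m≤n⇒∣n-m∣≡n∸m b≤a)) (≋⇒∣∸ b≤a (sym e))

-- The distance stands for M - g because the progressions in `Density` also run beyond M, where
-- `M ∸ g` would be 0.
avoids : ℕ → ℕ → ℕ → Bool
avoids M p g = not (does (p ∣? g)) ∧ not (does (p ∣? ∣ g - M ∣))

removed : ℕ → ℕ → ℕ
removed M p = if does (p ∣? M) then 1 else 2

removed-∣ : ∀ {M p} → p ∣ M → removed M p ≡ 1
removed-∣ {M} {p} d = cong (λ b → if b then 1 else 2) (dec-true (p ∣? M) d)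

module _ {f Π W E} (dens : Density f Π W E) (Π≤W : Π ≤ W) (M p : ℕ) (pp : Prime p) (p∤W : ¬ p ∣ W) where
  private
    instance
      p≢0 : NonZero p
      p≢0 = prime⇒nonZero pp
    open Distance p
    open Mod p

    cp : Coprime p W
    cp = prime-coprime W pp p∤W

    f' : ℕ → Bool
    f' g = f g ∧ avoids M p g

    Bounds : ℕ → ℕ → ℕ → Set
    Bounds ν N C = p * W * C ≤ N * ((p ∸ ν) * Π) + (ν + suc ν * E) * (p * W) × N * ((p ∸ ν) * Π) ≤ p * W * C + (ν + suc ν * E) * (p * W)

    combine-bounds : ∀ ν N A C D → ν ≤ p → A ≡ D + C →
      p * W * D ≤ ν * (N * Π) + ν * (suc E * (p * W)) → ν * (N * Π) ≤ p * W * D + ν * (suc E * (p * W)) →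
      W * A ≤ N * Π + E * W → N * Π ≤ W * A + E * W →
      Bounds ν N C
    combine-bounds ν N A C D ν≤p refl D≤ ≤D A≤ ≤A = +-cancelʳ-≤ (p * W * D) _ _ upper , +-cancelʳ-≤ (ν * (N * Π)) _ _ lower
      where
      open ≤-Reasoning
      q = p ∸ ν
      qν : q + ν ≡ p
      qν = m∸n+n≡m ν≤p
      e₁ : ∀ p W C D → p * W * C + p * W * D ≡ p * (W * (D + C))
      e₁ = solve-∀
      e₂ : ∀ p N Π E W → p * (N * Π + E * W) ≡ p * (N * Π) + p * (E * W)
      e₂ = solve-∀
      e₃ : ∀ q ν N Π X → (q + ν) * (N * Π) + X ≡ N * (q * Π) + X + ν * (N * Π)
      e₃ = solve-∀
      e₄ : ∀ q Π N ν E p W X → N * (q * Π) + p * (E * W) + (X + ν * ((1 + E) * (p * W))) ≡ N * (q * Π) + (ν + (1 + ν) * E) * (p * W) + X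
      e₄ = solve-∀
      e₅ : ∀ p W C D E → p * (W * (D + C) + E * W) ≡ p * W * C + p * (E * W) + p * W * D
      e₅ = solve-∀
      e₆ : ∀ p W C ν E X → p * W * C + p * (E * W) + (X + ν * ((1 + E) * (p * W))) ≡ p * W * C + (ν + (1 + ν) * E) * (p * W) + X
      e₆ = solve-∀
      upper : p * W * C + p * W * D ≤ N * (q * Π) + (ν + suc ν * E) * (p * W) + p * W * D
      upper = begin
        p * W * C + p * W * D ≡⟨ e₁ p W C D ⟩
        p * (W * (D + C)) ≤⟨ *-monoʳ-≤ p A≤ ⟩
        p * (N * Π + E * W) ≡⟨ e₂ p N Π E W ⟩
        p * (N * Π) + p * (E * W) ≡⟨ cong (λ x → x * (N * Π) + p * (E * W)) (sym qν) ⟩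
        (q + ν) * (N * Π) + p * (E * W) ≡⟨ e₃ q ν N Π (p * (E * W)) ⟩
        N * (q * Π) + p * (E * W) + ν * (N * Π) ≤⟨ +-monoʳ-≤ _ ≤D ⟩
        N * (q * Π) + p * (E * W) + (p * W * D + ν * (suc E * (p * W))) ≡⟨ e₄ q Π N ν E p W (p * W * D) ⟩
        N * (q * Π) + (ν + suc ν * E) * (p * W) + p * W * D ∎
      lower : N * (q * Π) + ν * (N * Π) ≤ p * W * C + (ν + suc ν * E) * (p * W) + ν * (N * Π)
      lower = begin
        N * (q * Π) + ν * (N * Π) ≡⟨ trans (cong (_+ ν * (N * Π)) (sym (+-identityʳ _))) (sym (e₃ q ν N Π 0)) ⟩
        (q + ν) * (N * Π) + 0 ≡⟨ trans (+-identityʳ _) (cong (_* (N * Π)) qν) ⟩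
        p * (N * Π) ≤⟨ *-monoʳ-≤ p ≤A ⟩
        p * (W * (D + C) + E * W) ≡⟨ e₅ p W C D E ⟩
        p * W * C + p * (E * W) + p * W * D ≤⟨ +-monoʳ-≤ _ D≤ ⟩
        p * W * C + p * (E * W) + (ν * (N * Π) + ν * (suc E * (p * W))) ≡⟨ e₆ p W C ν E (ν * (N * Π)) ⟩
        p * W * C + (ν + suc ν * E) * (p * W) + ν * (N * Π) ∎

  -- The forbidden classes modulo p are those of 0 and M. They coincide when p divides M and are
  -- disjoint otherwise.
  density-avoids : Density f' ((p ∸ removed M p) * Π) (p * W) (removed M p + suc (removed M p) * E)
  density-avoids x Q N cQ = bounds
    where
    cQW : Coprime Q W
    cQW (d∣Q , d∣W) = cQ (d∣Q , ∣n⇒∣m*n p d∣W)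
    cQp : Coprime Q p
    cQp (d∣Q , d∣p) = cQ (d∣Q , ∣m⇒∣m*n W d∣p)
    F = progression f x Q
    g : ℕ → ℕ
    g h = x + Q * h
    A = count F N
    C = count (progression f' x Q) N
    D : ℕ → ℕ
    D c = count (λ h → F h ∧ does (g h % p ≟ c % p)) N
    res = λ c → Residue.density-residue {f} {Π} {W} {E} dens Π≤W p cp x Q N c cQW cQp
    ih = dens x Q N cQW

    D₀ : D 0 ≡ count (λ h → F h ∧ does (p ∣? g h)) N
    D₀ = count-cong N λ h _ → cong (F h ∧_) (does-⇔ (mk⇔ (λ e → ≋0⇒∣ e) ∣⇒≋0) (g h % p ≟ 0 % p) (p ∣? g h))

    D₁ : D M ≡ count (λ h → F h ∧ does (p ∣? ∣ g h - M ∣)) N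
    D₁ = count-cong N λ h _ → cong (F h ∧_) (does-⇔ (mk⇔ (λ e → ≋⇒∣dist (g h) M e) (∣dist⇒≋ (g h) M)) (g h % p ≟ M % p) (p ∣? ∣ g h - M ∣))

    one : p ∣ M → A ≡ D 0 + C
    one p∣M = trans (count-split F (λ h → does (p ∣? g h)) N) (cong₂ _+_ (sym D₀) (count-cong N λ h _ → cong (F h ∧_) (same h)))
      where
      same : ∀ h → not (does (p ∣? g h)) ≡ avoids M p (g h)
      same h with does (p ∣? g h) | does (p ∣? ∣ g h - M ∣)
                  | does-⇔ (mk⇔ (λ d → ≋⇒∣dist (g h) M (trans (∣⇒≋0 d) (sym (∣⇒≋0 p∣M)))) (λ d → ≋0⇒∣ (trans (∣dist⇒≋ (g h) M d) (∣⇒≋0 p∣M))))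
                       (p ∣? g h) (p ∣? ∣ g h - M ∣)
      ... | true  | _ | _ = refl
      ... | false | _ | refl = refl

    two : ¬ p ∣ M → A ≡ D 0 + D M + C
    two p∤M = begin
      A ≡⟨ count-split F (λ h → does (p ∣? g h)) N ⟩
      count (λ h → F h ∧ does (p ∣? g h)) N + count (λ h → F h ∧ not (does (p ∣? g h))) N ≡⟨ cong₂ _+_ (sym D₀) (count-split (λ h → F h ∧ not (does (p ∣? g h))) (λ h → does (p ∣? ∣ g h - M ∣)) N) ⟩
      D 0 + (count (λ h → (F h ∧ not (does (p ∣? g h))) ∧ does (p ∣? ∣ g h - M ∣)) N
           + count (λ h → (F h ∧ not (does (p ∣? g h))) ∧ not (does (p ∣? ∣ g h - M ∣))) N)
        ≡⟨ cong (D 0 +_) (cong₂ _+_ (trans (count-cong N disjoint) (sym D₁)) (count-cong N λ h _ → ∧-assoc (F h) _ _)) ⟩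
      D 0 + (D M + C) ≡⟨ sym (+-assoc (D 0) (D M) C) ⟩
      D 0 + D M + C ∎
      where
      open ≡-Reasoning
      disjoint : ∀ h → h < N → ((F h ∧ not (does (p ∣? g h))) ∧ does (p ∣? ∣ g h - M ∣)) ≡ (F h ∧ does (p ∣? ∣ g h - M ∣))
      disjoint h _ with F h | p ∣? g h | p ∣? ∣ g h - M ∣
      ... | false | _     | _     = refl
      ... | true  | no _  | _     = refl
      ... | true  | yes _ | no _  = refl
      ... | true  | yes a | yes b = contradiction (≋0⇒∣ (trans (sym (∣dist⇒≋ (g h) M b)) (∣⇒≋0 a))) p∤M

    bounds : Bounds (removed M p) N C
    bounds with p ∣? M
    ... | yes p∣M = combine-bounds 1 N A C (D 0) (>-nonZero⁻¹ p) (one p∣M)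
            (subst (p * W * D 0 ≤_) (cong₂ _+_ (sym (*-identityˡ (N * Π))) (sym (*-identityˡ (suc E * (p * W))))) (proj₁ (res 0)))
            (subst₂ _≤_ (sym (*-identityˡ _)) (cong (p * W * D 0 +_) (sym (*-identityˡ _))) (proj₂ (res 0)))
            (proj₁ ih) (proj₂ ih)
    ... | no p∤M = combine-bounds 2 N A C (D 0 + D M) (nonTrivial⇒n>1 p {{prime⇒nonTrivial pp}}) (two p∤M)
            (subst₂ _≤_ (sym (*-distribˡ-+ (p * W) (D 0) (D M))) (e₁ (N * Π) (suc E * (p * W))) (+-mono-≤ (proj₁ (res 0)) (proj₁ (res M))))
            (subst₂ _≤_ (cong (N * Π +_) (sym (+-identityʳ _))) (e₂ (p * W) (D 0) (D M) (suc E * (p * W))) (+-mono-≤ (proj₂ (res 0)) (proj₂ (res M))))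
            (proj₁ ih) (proj₂ ih)
      where
      e₁ : ∀ a b → a + b + (a + b) ≡ 2 * a + 2 * b
      e₁ = solve-∀
      e₂ : ∀ p a b c → p * a + c + (p * b + c) ≡ p * (a + b) + 2 * c
      e₂ = solve-∀

-- The sieve iterated over a set of primes

product< : (ℕ → ℕ) → ℕ → ℕ
product< F zero    = 1
product< F (suc k) = F k * product< F k

prime∣product< : ∀ {p} F → Prime p → ∀ B → p ∣ product< F B → ∃ λ j → j < B × p ∣ F j
prime∣product< F pp zero d = contradiction (subst NonTrivial (∣1⇒≡1 d) (prime⇒nonTrivial pp)) λ ()
prime∣product< F pp (suc k) d with euclidsLemma (F k) (product< F k) pp d
... | inj₁ d' = k , ≤-refl , d'
... | inj₂ d' = let j , j<k , e = prime∣product< F pp k d' in j , m≤n⇒m≤1+n j<k , e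

product<-mono : ∀ F G B → (∀ k → k < B → F k ≤ G k) → product< F B ≤ product< G B
product<-mono F G zero h = ≤-refl
product<-mono F G (suc k) h = *-mono-≤ (h k ≤-refl) (product<-mono F G k λ j j<k → h j (m≤n⇒m≤1+n j<k))

-- All products run over every k below a bound, with factor 1 where k is not selected. This replaces
-- lists of prime divisors and lets inequalities be multiplied pointwise.
module Sieve (M : ℕ) (sel : ℕ → Bool) (sel-prime : ∀ k → sel k ≡ true → Prime k) where
  modulus kept errors : ℕ → ℕ
  modulus k = if sel k then k else 1
  kept k    = if sel k then k ∸ removed M k else 1
  errors k  = if sel k then suc (removed M k) else 1

  sift : ℕ → ℕ → Bool
  sift zero    g = true
  sift (suc k) g = if sel k then (sift k g ∧ avoids M k g) else sift k g

  discrepancy : ℕ → ℕ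
  discrepancy zero    = 0
  discrepancy (suc k) = if sel k then removed M k + suc (removed M k) * discrepancy k else discrepancy k

  -- Adding 1 makes the recursion multiplicative: 1 + ν + (1 + ν) E = (1 + ν) (1 + E). This is the
  -- number of terms in Legendre's inclusion and exclusion.
  suc-discrepancy : ∀ B → suc (discrepancy B) ≡ product< errors B
  suc-discrepancy zero = refl
  suc-discrepancy (suc k) with sel k
  ... | true  = trans (lem (removed M k) (discrepancy k)) (cong (suc (removed M k) *_) (suc-discrepancy k))
    where
    lem : ∀ ν E → 1 + (ν + (1 + ν) * E) ≡ (1 + ν) * (1 + E)
    lem = solve-∀
  ... | false = trans (suc-discrepancy k) (sym (+-identityʳ _))

  kept≤modulus : ∀ k → kept k ≤ modulus k
  kept≤modulus k with sel k
  ... | true  = m∸n≤m k (removed M k)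
  ... | false = ≤-refl

  -- Primes are sieved in increasing order, so each new prime exceeds every prime in the modulus
  -- built so far.
  modulus∤ : ∀ k → Prime k → ¬ k ∣ product< modulus k
  modulus∤ k pk d = let j , j<k , k∣j = prime∣product< modulus pk k d in nope j j<k k∣j
    where
    nope : ∀ j → j < k → ¬ k ∣ modulus j
    nope j j<k k∣j with sel j in eq
    ... | true  = <⇒≱ j<k (∣⇒≤ {{prime⇒nonZero (sel-prime j eq)}} k∣j)
    ... | false = contradiction (subst NonTrivial (∣1⇒≡1 k∣j) (prime⇒nonTrivial pk)) λ ()

  density-sift : ∀ B → Density (sift B) (product< kept B) (product< modulus B) (discrepancy B)
  density-sift zero x Q N cQ = ≤-reflexive (lem N) , ≤-reflexive (trans (sym (+-identityʳ _)) (trans (sym (lem N)) (sym (+-identityʳ _))))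
    where
    all : ∀ N → count (λ _ → true) N ≡ N
    all zero = refl
    all (suc N) = cong suc (all N)
    lem : ∀ N → 1 * count (λ _ → true) N ≡ N * 1 + 0
    lem N = trans (trans (*-identityˡ _) (all N)) (sym (trans (+-identityʳ _) (*-identityʳ N)))
  density-sift (suc k) with sel k in eq
  ... | true = density-avoids {sift k} {product< kept k} {product< modulus k} {discrepancy k} (density-sift k)
                 (product<-mono kept modulus k λ j _ → kept≤modulus j) M k (sel-prime k eq) (modulus∤ k (sel-prime k eq))
  ... | false rewrite +-identityʳ (product< modulus k) | +-identityʳ (product< kept k) = density-sift k

  sift-avoids : ∀ B k g → k < B → sel k ≡ true → sift B g ≡ true → ¬ k ∣ g × ¬ k ∣ ∣ g - M ∣
  sift-avoids (suc B) k g k<1+B sk p with k ≟ B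
  ... | yes refl = avoided (sel B) sk p
    where
    avoided : ∀ b → b ≡ true → (if b then (sift B g ∧ avoids M B g) else sift B g) ≡ true → ¬ B ∣ g × ¬ B ∣ ∣ g - M ∣
    avoided true _ p with B ∣? g | B ∣? ∣ g - M ∣ | proj₂ (∧-elim {sift B g} p)
    ... | no a | no b | _ = a , b
  ... | no k≢B = sift-avoids B k g (≤∧≢⇒< (s≤s⁻¹ k<1+B) k≢B) sk (weaken (sel B) p)
    where
    weaken : ∀ b → (if b then (sift B g ∧ avoids M B g) else sift B g) ≡ true → sift B g ≡ true
    weaken true  p = proj₁ (∧-elim {sift B g} p)
    weaken false p = p

-- Products over the sieving primes

^-distribʳ-* : ∀ e a b → (a * b) ^ e ≡ a ^ e * b ^ e
^-distribʳ-* zero a b = refl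
^-distribʳ-* (suc e) a b rewrite ^-distribʳ-* e a b = lem a b _ _
  where
  lem : ∀ a b c d → a * b * (c * d) ≡ a * c * (b * d)
  lem = solve-∀

product<-* : ∀ F G B → product< (λ k → F k * G k) B ≡ product< F B * product< G B
product<-* F G zero = refl
product<-* F G (suc k) rewrite product<-* F G k = lem (F k) (G k) _ _
  where
  lem : ∀ a b c d → a * b * (c * d) ≡ a * c * (b * d)
  lem = solve-∀

product<-^ : ∀ F e B → product< (λ k → F k ^ e) B ≡ product< F B ^ e
product<-^ F e zero = sym (^-zeroˡ e)
product<-^ F e (suc k) rewrite product<-^ F e k = sym (^-distribʳ-* e (F k) (product< F k))

product<-≥1 : ∀ F B → (∀ k → 1 ≤ F k) → 1 ≤ product< F B
product<-≥1 F zero h = ≤-refl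
product<-≥1 F (suc k) h = *-mono-≤ (h k) (product<-≥1 F k h)

product<-extend : ∀ F B d → (∀ k → 1 ≤ F k) → product< F B ≤ product< F (d + B)
product<-extend F B zero h = ≤-refl
product<-extend F B (suc d) h = ≤-trans (product<-extend F B d h) (≤-trans (≤-reflexive (sym (*-identityˡ _))) (*-monoˡ-≤ _ (h (d + B))))

-- Extending the product to `B₀ + B` treats B below and above B₀ alike.
product<-eventually-1 : ∀ F B₀ → (∀ k → 1 ≤ F k) → (∀ d → F (B₀ + d) ≡ 1) → ∀ B → product< F B ≤ product< F B₀
product<-eventually-1 F B₀ h one B = ≤-trans (product<-extend F B B₀ h) (≤-reflexive (trans (cong (product< F) (+-comm B₀ B)) (constant B)))
  where
  constant : ∀ d → product< F (d + B₀) ≡ product< F B₀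
  constant zero = refl
  constant (suc d) = trans (cong₂ _*_ (trans (cong F (+-comm d B₀)) (one d)) (constant d)) (*-identityˡ _)

at : ℕ → ℕ → ℕ → ℕ
at q v k = if does (k ≟ q) then v else 1

at≥1 : ∀ q v → 1 ≤ v → ∀ k → 1 ≤ at q v k
at≥1 q v 1≤v k with does (k ≟ q)
... | true  = 1≤v
... | false = ≤-refl

product<-at : ∀ q v → 1 ≤ v → ∀ B → product< (at q v) B ≤ v
product<-at q v 1≤v B = ≤-trans (product<-eventually-1 (at q v) (suc q) (at≥1 q v 1≤v)
    (λ d → cong (λ b → if b then v else 1) (dec-false (suc q + d ≟ q) λ e → <-irrefl (sym e) (s≤s (m≤m+n q d)))) B)
  (≤-reflexive (trans (cong₂ _*_ (cong (λ b → if b then v else 1) (dec-true (q ≟ q) refl)) (below q ≤-refl)) (*-identityʳ v)))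
  where
  below : ∀ B → B ≤ q → product< (at q v) B ≡ 1
  below zero _ = refl
  below (suc k) k<q = trans (cong₂ _*_ (cong (λ b → if b then v else 1) (dec-false (k ≟ q) (<⇒≢ k<q))) (below k (<⇒≤ k<q))) refl

^-cancelˡ-≤ : ∀ e {x y} .{{_ : NonZero e}} → x ^ e ≤ y ^ e → x ≤ y
^-cancelˡ-≤ e h = ≮⇒≥ λ y<x → <⇒≱ (^-monoˡ-< e y<x) h

-- For primes k ≥ 5 not listed, (3 k)⁵ ≤ k² (k − 2)⁵ and k¹⁰ ≤ k (k − 2)¹⁰ hold without a constant.  Multiplied over
-- the primes of n, they bound ∏ 3 p / (p − 2) by O(n^(2/5)) and ∏ p / (p − 2) by O(n^(1/10)).
c₅ : ℕ → ℕ
c₅ 5  = 125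
c₅ 7  = 27
c₅ 11 = 6
c₅ 13 = 4
c₅ 17 = 2
c₅ 19 = 2
c₅ _  = 1

c₁₀ : ℕ → ℕ
c₁₀ 5 = 34
c₁₀ 7 = 5
c₁₀ _ = 1

c₅≥1 : ∀ k → 1 ≤ c₅ k
c₅≥1 k with k <? 20
... | yes k<20 = toWitness {a? = allUpTo? (λ k → 1 ≤? c₅ k) 20} tt k<20
... | no k≮20 = subst (λ k → 1 ≤ c₅ k) (m+[n∸m]≡n (≮⇒≥ k≮20)) ≤-refl

c₁₀≥1 : ∀ k → 1 ≤ c₁₀ k
c₁₀≥1 k with k <? 8
... | yes k<8 = toWitness {a? = allUpTo? (λ k → 1 ≤? c₁₀ k) 8} tt k<8
... | no k≮8 = subst (λ k → 1 ≤ c₁₀ k) (m+[n∸m]≡n (≮⇒≥ k≮8)) ≤-refl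

-- This is k / q ≤ b / a and (b / a)ᵉ ≤ c, freed of denominators.
power-ratio : ∀ e a b c k q .{{_ : NonZero a}} → a * k ≤ b * q → b ^ e ≤ a ^ e * c → k ^ e ≤ c * q ^ e
power-ratio e a b c k q h hc = *-cancelˡ-≤ (a ^ e) {{m^n≢0 a e}} (begin
  a ^ e * k ^ e ≡⟨ sym (^-distribʳ-* e a k) ⟩
  (a * k) ^ e ≤⟨ ^-monoˡ-≤ e h ⟩
  (b * q) ^ e ≡⟨ ^-distribʳ-* e b q ⟩
  b ^ e * q ^ e ≤⟨ *-monoˡ-≤ (q ^ e) hc ⟩
  a ^ e * c * q ^ e ≡⟨ *-assoc (a ^ e) c (q ^ e) ⟩
  a ^ e * (c * q ^ e) ∎)
  where open ≤-Reasoning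

minus-two-ratio : ∀ a k → 2 + a ≤ k → a * k ≤ (2 + a) * (k ∸ 2)
minus-two-ratio a k h = begin
  a * k ≡⟨ cong (a *_) (sym q+2) ⟩
  a * (q + 2) ≡⟨ e₁ a q ⟩
  a * q + 2 * a ≤⟨ +-monoʳ-≤ (a * q) (*-monoʳ-≤ 2 (+-cancelʳ-≤ 2 a q (subst₂ _≤_ (+-comm 2 a) (sym q+2) h))) ⟩
  a * q + 2 * q ≡⟨ e₂ a q ⟩
  (2 + a) * q ∎
  where
  open ≤-Reasoning
  q = k ∸ 2
  q+2 : q + 2 ≡ k
  q+2 = m∸n+n≡m (≤-trans (m≤m+n 2 a) h)
  e₁ : ∀ a q → a * (q + 2) ≡ a * q + 2 * a
  e₁ = solve-∀
  e₂ : ∀ a q → a * q + 2 * q ≡ (2 + a) * q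
  e₂ = solve-∀

-- Three of the five factors k are exchanged for q at the cost of 2, and the other two factors q pay
-- for everything: 3⁵ · 2 = 486 ≤ 27².
weight₅-large : ∀ k q → 27 ≤ q → k ^ 3 ≤ 2 * q ^ 3 → (3 * k) ^ 5 ≤ k ^ 2 * q ^ 5
weight₅-large k q 27≤q h = begin
  (3 * k) ^ 5 ≡⟨ e₁ k ⟩
  k ^ 2 * (243 * k ^ 3) ≤⟨ *-monoʳ-≤ (k ^ 2) (begin
    243 * k ^ 3 ≤⟨ *-monoʳ-≤ 243 h ⟩
    243 * (2 * q ^ 3) ≡⟨ sym (*-assoc 243 2 (q ^ 3)) ⟩
    486 * q ^ 3 ≤⟨ *-monoˡ-≤ (q ^ 3) (≤-trans (≤ᵇ⇒≤ 486 (27 * 27) tt) (*-mono-≤ 27≤q 27≤q)) ⟩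
    q * q * q ^ 3 ∎) ⟩
  k ^ 2 * (q * q * q ^ 3) ≡⟨ cong (k ^ 2 *_) (e₂ q) ⟩
  k ^ 2 * q ^ 5 ∎
  where
  open ≤-Reasoning
  e₁ : ∀ k → (3 * k) * ((3 * k) * ((3 * k) * ((3 * k) * ((3 * k) * 1)))) ≡ k * (k * 1) * (243 * (k * (k * (k * 1))))
  e₁ = solve-∀
  e₂ : ∀ q → (q * q) * (q * (q * (q * 1))) ≡ q * (q * (q * (q * (q * 1))))
  e₂ = solve-∀

weight₅ : ∀ k → Prime k → 5 ≤ k → (3 * k) ^ 5 ≤ c₅ k * (k ^ 2 * (k ∸ 2) ^ 5)
weight₅ k pk 5≤k with k <? 29
... | yes k<29 = toWitness {a? = allUpTo? (λ k → prime? k →-dec (5 ≤? k →-dec ((3 * k) ^ 5 ≤? c₅ k * (k ^ 2 * (k ∸ 2) ^ 5)))) 29} tt k<29 pk 5≤k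
... | no k≮29 = ≤-trans (weight₅-large k (k ∸ 2) (∸-monoˡ-≤ 2 (≮⇒≥ k≮29))
    (power-ratio 3 27 29 2 k (k ∸ 2) (minus-two-ratio 27 k (≮⇒≥ k≮29)) (≤ᵇ⇒≤ (29 ^ 3) (27 ^ 3 * 2) tt)))
  (≤-trans (≤-reflexive (sym (*-identityˡ _))) (*-monoˡ-≤ _ (c₅≥1 k)))

weight₁₀ : ∀ k → Prime k → 5 ≤ k → k ^ 10 ≤ c₁₀ k * (k * (k ∸ 2) ^ 10)
weight₁₀ k pk 5≤k with k <? 11
... | yes k<11 = toWitness {a? = allUpTo? (λ k → prime? k →-dec (5 ≤? k →-dec (k ^ 10 ≤? c₁₀ k * (k * (k ∸ 2) ^ 10)))) 11} tt k<11 pk 5≤k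
... | no k≮11 = ≤-trans (*-monoʳ-≤ k (≤-trans
    -- From 11 on, (k / (k - 2))⁹ ≤ (11 / 9)⁹ ≤ 9, and 9 is at most the tenth factor k - 2.
    (power-ratio 9 9 11 9 k (k ∸ 2) (minus-two-ratio 9 k (≮⇒≥ k≮11)) (≤ᵇ⇒≤ (11 ^ 9) (9 ^ 9 * 9) tt))
    (*-monoˡ-≤ ((k ∸ 2) ^ 9) (∸-monoˡ-≤ 2 (≮⇒≥ k≮11)))))
  (≤-trans (≤-reflexive (sym (*-identityˡ _))) (*-monoˡ-≤ _ (c₁₀≥1 k)))

square-bound₅ : ∀ c k → c * 4 ≤ k → c * (2 * (k * k)) ^ 2 ≤ k ^ 5
square-bound₅ c k h = begin
  c * (2 * (k * k)) ^ 2 ≡⟨ e₁ c k ⟩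
  c * 4 * (k * k * (k * k)) ≤⟨ *-monoˡ-≤ (k * k * (k * k)) h ⟩
  k * (k * k * (k * k)) ≡⟨ e₂ k ⟩
  k ^ 5 ∎
  where
  open ≤-Reasoning
  e₁ : ∀ c k → c * ((2 * (k * k)) * ((2 * (k * k)) * 1)) ≡ c * 4 * (k * k * (k * k))
  e₁ = solve-∀
  e₂ : ∀ k → k * (k * k * (k * k)) ≡ k * (k * (k * (k * (k * 1))))
  e₂ = solve-∀

square-bound₁₀ : ∀ c k → c * 2 ≤ k * k * k → c * (2 * (k * k)) ≤ k ^ 5
square-bound₁₀ c k h = begin
  c * (2 * (k * k)) ≡⟨ sym (*-assoc c 2 (k * k)) ⟩
  c * 2 * (k * k) ≤⟨ *-monoˡ-≤ (k * k) h ⟩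
  k * k * k * (k * k) ≡⟨ e₂ k ⟩
  k ^ 5 ∎
  where
  open ≤-Reasoning
  e₂ : ∀ k → k * k * k * (k * k) ≡ k * (k * (k * (k * (k * 1))))
  e₂ = solve-∀

-- For k = m² and p at most 2 m⁴, c p² is at most 4 c k⁴ and hence at most k⁵.
fifth-root : ∀ c k {t p r} → c * 4 ≤ k → t ^ 5 ≤ c * (p ^ 2 * r ^ 5) → p ≤ 2 * (k * k) → t ≤ k * r
fifth-root c k {t} {p} {r} c4≤k h p≤ = ^-cancelˡ-≤ 5 (begin
  t ^ 5 ≤⟨ h ⟩
  c * (p ^ 2 * r ^ 5) ≡⟨ sym (*-assoc c (p ^ 2) (r ^ 5)) ⟩
  c * p ^ 2 * r ^ 5 ≤⟨ *-monoˡ-≤ (r ^ 5) (≤-trans (*-monoʳ-≤ c (^-monoˡ-≤ 2 p≤)) (square-bound₅ c k c4≤k)) ⟩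
  k ^ 5 * r ^ 5 ≡⟨ sym (^-distribʳ-* 5 k r) ⟩
  (k * r) ^ 5 ∎)
  where open ≤-Reasoning

-- One factor p is bounded by 2 m⁴; what remains of m¹⁰ is m⁶, which must exceed 2 a¹⁰ c.
tenth-root : ∀ c a m {p r} → a ^ 10 * c * 2 ≤ m * m * (m * m) * (m * m) → p ^ 10 ≤ c * (p * r ^ 10) → p ≤ 2 * (m * m * (m * m)) → a * p ≤ m * r
tenth-root c a m {p} {r} hc h p≤ = ^-cancelˡ-≤ 10 (begin
  (a * p) ^ 10 ≡⟨ ^-distribʳ-* 10 a p ⟩
  a ^ 10 * p ^ 10 ≤⟨ *-monoʳ-≤ (a ^ 10) h ⟩
  a ^ 10 * (c * (p * r ^ 10)) ≡⟨ e (a ^ 10) c p (r ^ 10) ⟩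
  a ^ 10 * c * p * r ^ 10 ≤⟨ *-monoˡ-≤ (r ^ 10) (≤-trans (*-monoʳ-≤ (a ^ 10 * c) p≤) (square-bound₁₀ (a ^ 10 * c) (m * m) hc)) ⟩
  (m * m) ^ 5 * r ^ 10 ≡⟨ cong (_* r ^ 10) (trans (^-distribʳ-* 5 m m) (sym (^-distribˡ-+-* m 5 5))) ⟩
  m ^ 10 * r ^ 10 ≡⟨ sym (^-distribʳ-* 10 m r) ⟩
  (m * r) ^ 10 ∎)
  where
  open ≤-Reasoning
  e : ∀ a c p r → a * (c * (p * r)) ≡ a * c * p * r
  e = solve-∀

-- Main term and error of the sieve

module Products (n m M : ℕ) .{{_ : NonZero n}} (2∤n : ¬ 2 ∣ n) (3∤n : ¬ 3 ∣ n) (2604≤m : 2604 ≤ m)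
  (n≤2m⁴ : n ≤ 2 * (m * m * (m * m))) (q₁ q₂ q₃ : ℕ) (q₁∣M : q₁ ∣ M) (q₂∣M : q₂ ∣ M) (q₃∣M : q₃ ∣ M) where

  abstract
    base? : ∀ k → Dec (Prime k × k ∣ n)
    base? k = prime? k ×-dec (k ∣? n)

  Extra : ℕ → Set
  Extra k = k ≡ q₁ ⊎ k ≡ q₂ ⊎ k ≡ q₃

  abstract
    sieved? : ∀ k → Dec (Prime k × (k ∣ n ⊎ Extra k))
    sieved? k = prime? k ×-dec ((k ∣? n) ⊎-dec ((k ≟ q₁) ⊎-dec ((k ≟ q₂) ⊎-dec (k ≟ q₃))))

  private
    sel₀ sel : ℕ → Bool
    sel₀ k = does (base? k)
    sel k  = does (sieved? k)
    module S₀ = Sieve M sel₀ (λ k e → proj₁ (does⇒ (base? k) e))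

  module S = Sieve M sel (λ k e → proj₁ (does⇒ (sieved? k) e))

  -- The worst case at a prime p of n is the removal of two classes: `P` over `R` is the loss of
  -- density p / (p - 2), and `T` over `R` is this loss times the error factor 3.
  P R T : ℕ → ℕ
  P k = if sel₀ k then k else 1
  R k = if sel₀ k then k ∸ 2 else 1
  T k = if sel₀ k then 3 * k else 1

  base≥5 : ∀ {k} → Prime k → k ∣ n → 5 ≤ k
  base≥5 {0} pk k∣n = contradiction pk (from-no (prime? 0))
  base≥5 {1} pk k∣n = contradiction pk (from-no (prime? 1))
  base≥5 {2} pk k∣n = contradiction k∣n 2∤n
  base≥5 {3} pk k∣n = contradiction k∣n 3∤n
  base≥5 {4} pk k∣n = contradiction pk (from-no (prime? 4))
  base≥5 {suc (suc (suc (suc (suc k))))} pk k∣n = s≤s (s≤s (s≤s (s≤s (s≤s z≤n))))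

  product-base∣n : ∀ B → product< P B ∣ n
  product-base∣n zero = 1∣ n
  product-base∣n (suc k) with base? k
  ... | yes (pk , k∣n) = lcm-∣ (prime-coprime _ pk (S₀.modulus∤ k pk)) k∣n (product-base∣n k)
    where
    lcm-∣ : ∀ {a b c} → Coprime a b → a ∣ c → b ∣ c → a * b ∣ c
    lcm-∣ {a} {b} cab a∣c (divides q refl) = *-monoˡ-∣ b (coprime-divisor cab (subst (a ∣_) (*-comm q b) a∣c))
  ... | no _ = subst (_∣ n) (sym (+-identityʳ _)) (product-base∣n k)

  private
    k₂ = m * m
    k₂≥ : 6780816 ≤ k₂
    k₂≥ = ≤-trans (≤ᵇ⇒≤ 6780816 (2604 * 2604) tt) (*-mono-≤ 2604≤m 2604≤m)

  product-≤-constants : ∀ (c : ℕ → ℕ) B₀ → (∀ k → 1 ≤ c k) → (∀ d → c (B₀ + d) ≡ 1) → ∀ F G B →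
    (∀ k → F k ≤ c k * G k) → product< F B ≤ product< c B₀ * product< G B
  product-≤-constants c B₀ c≥1 c1 F G B h = ≤-trans (product<-mono F (λ k → c k * G k) B (λ k _ → h k))
    (≤-trans (≤-reflexive (product<-* c G B)) (*-monoˡ-≤ (product< G B) (product<-eventually-1 c B₀ c≥1 c1 B)))

  R≥1 : ∀ k → 1 ≤ R k
  R≥1 k with base? k
  ... | yes (pk , k∣n) = ∸-monoˡ-≤ 2 (≤-trans (≤ᵇ⇒≤ 3 5 tt) (base≥5 pk k∣n))
  ... | no _ = ≤-refl

  P≤2m⁴ : ∀ B → product< P B ≤ 2 * (m * m * (m * m))
  P≤2m⁴ B = ≤-trans (∣⇒≤ (product-base∣n B)) n≤2m⁴

  triple-bound : ∀ B → product< T B ≤ m * m * product< R B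
  -- 324000 = 125 · 27 · 6 · 4 · 2 · 2 is the product of the values of `c₅`, and 6780816 = 2604².
  triple-bound B = fifth-root 324000 (m * m) (≤-trans (≤ᵇ⇒≤ (324000 * 4) 6780816 tt) k₂≥) (begin
    product< T B ^ 5 ≡⟨ sym (product<-^ T 5 B) ⟩
    product< (λ k → T k ^ 5) B ≤⟨ product-≤-constants c₅ 20 c₅≥1 (λ _ → refl) _ (λ k → P k ^ 2 * R k ^ 5) B pointwise ⟩
    product< c₅ 20 * product< (λ k → P k ^ 2 * R k ^ 5) B ≡⟨ cong (product< c₅ 20 *_) (trans (product<-* (λ k → P k ^ 2) (λ k → R k ^ 5) B) (cong₂ _*_ (product<-^ P 2 B) (product<-^ R 5 B))) ⟩
    product< c₅ 20 * (product< P B ^ 2 * product< R B ^ 5) ∎) (P≤2m⁴ B)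
    where
    open ≤-Reasoning
    pointwise : ∀ k → T k ^ 5 ≤ c₅ k * (P k ^ 2 * R k ^ 5)
    pointwise k with base? k
    ... | yes (pk , k∣n) = weight₅ k pk (base≥5 pk k∣n)
    ... | no _ = *-mono-≤ (c₅≥1 k) ≤-refl

  base-bound : ∀ B → 60 * product< P B ≤ m * product< R B
  -- 170 = 34 · 5 comes from `c₁₀`. The factor 60 has to beat 48 in `sieve-beats`; among the
  -- numerical conditions on m, 60¹⁰ · 340 ≤ m⁶ is the most demanding.
  base-bound B = tenth-root 170 60 m (≤-trans (≤ᵇ⇒≤ (60 ^ 10 * 170 * 2) (6780816 * 6780816 * 6780816) tt) (*-mono-≤ (*-mono-≤ k₂≥ k₂≥) k₂≥)) (begin
    product< P B ^ 10 ≡⟨ sym (product<-^ P 10 B) ⟩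
    product< (λ k → P k ^ 10) B ≤⟨ product-≤-constants c₁₀ 8 c₁₀≥1 (λ _ → refl) _ (λ k → P k * R k ^ 10) B pointwise ⟩
    product< c₁₀ 8 * product< (λ k → P k * R k ^ 10) B ≡⟨ cong (product< c₁₀ 8 *_) (trans (product<-* P (λ k → R k ^ 10) B) (cong (product< P B *_) (product<-^ R 10 B))) ⟩
    product< c₁₀ 8 * (product< P B * product< R B ^ 10) ∎) (P≤2m⁴ B)
    where
    open ≤-Reasoning
    pointwise : ∀ k → P k ^ 10 ≤ c₁₀ k * (P k * R k ^ 10)
    pointwise k with base? k
    ... | yes (pk , k∣n) = weight₁₀ k pk (base≥5 pk k∣n)
    ... | no _ = *-mono-≤ (c₁₀≥1 k) ≤-refl

  -- A prime sieved only because it divides M loses one class, and p / (p − 1) ≤ 2, 2 p / (p − 1) ≤ 4.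
  extra : ℕ → ℕ → ℕ
  extra v k = at q₁ v k * (at q₂ v k * at q₃ v k)

  extra≥1 : ∀ v → 1 ≤ v → ∀ k → 1 ≤ extra v k
  extra≥1 v 1≤v k = *-mono-≤ (at≥1 q₁ v 1≤v k) (*-mono-≤ (at≥1 q₂ v 1≤v k) (at≥1 q₃ v 1≤v k))

  extra≥ : ∀ v → 1 ≤ v → ∀ k → Extra k → v ≤ extra v k
  extra≥ v 1≤v k e = go e
    where
    at≡ : ∀ q → at q v q ≡ v
    at≡ q = cong (λ b → if b then v else 1) (dec-true (q ≟ q) refl)
    one : ∀ q → 1 ≤ at q v k
    one q = at≥1 q v 1≤v k
    go : Extra k → v ≤ extra v k
    go (inj₁ refl) = ≤-trans (≤-reflexive (trans (sym (at≡ q₁)) (sym (*-identityʳ _)))) (*-monoʳ-≤ (at q₁ v k) (*-mono-≤ (one q₂) (one q₃)))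
    go (inj₂ (inj₁ refl)) = ≤-trans (≤-reflexive (trans (sym (at≡ q₂)) (trans (sym (*-identityʳ _)) (sym (*-identityˡ _))))) (*-mono-≤ (one q₁) (*-monoʳ-≤ (at q₂ v k) (one q₃)))
    go (inj₂ (inj₂ refl)) = ≤-trans (≤-reflexive (trans (sym (at≡ q₃)) (trans (sym (*-identityˡ _)) (sym (*-identityˡ _))))) (*-mono-≤ (one q₁) (*-monoˡ-≤ (at q₃ v k) (one q₂)))

  product-extra : ∀ v → 1 ≤ v → ∀ B → product< (extra v) B ≤ v * (v * v)
  product-extra v 1≤v B = ≤-trans (≤-reflexive (trans (product<-* (at q₁ v) _ B) (cong (product< (at q₁ v) B *_) (product<-* (at q₂ v) (at q₃ v) B))))
    (*-mono-≤ (product<-at q₁ v 1≤v B) (*-mono-≤ (product<-at q₂ v 1≤v B) (product<-at q₃ v 1≤v B)))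

  extra∣M : ∀ {k} → Extra k → k ∣ M
  extra∣M (inj₁ refl) = q₁∣M
  extra∣M (inj₂ (inj₁ refl)) = q₂∣M
  extra∣M (inj₂ (inj₂ refl)) = q₃∣M

  removed≤2 : ∀ k → removed M k ≤ 2
  removed≤2 k with does (k ∣? M)
  ... | true  = s≤s z≤n
  ... | false = ≤-refl

  double-pred : ∀ {k} → Prime k → k ≤ (k ∸ 1) * 2
  double-pred {k} pk = begin
    k ≡⟨ sym (m+[n∸m]≡n (<⇒≤ 1<k)) ⟩
    1 + (k ∸ 1) ≤⟨ +-monoˡ-≤ (k ∸ 1) (m<n⇒0<n∸m 1<k) ⟩
    (k ∸ 1) + (k ∸ 1) ≡⟨ lem (k ∸ 1) ⟩
    (k ∸ 1) * 2 ∎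
    where
    open ≤-Reasoning
    1<k : 1 < k
    1<k = nonTrivial⇒n>1 k {{prime⇒nonTrivial pk}}
    lem : ∀ a → a + a ≡ a * 2
    lem = solve-∀

  -- Modulus over kept, compared factor by factor with `P` over `R` and cross-multiplied to stay in
  -- ℕ. A q that also divides n is already paid for by `P` over `R`.
  kept-pointwise : ∀ k → S.modulus k * R k ≤ P k * S.kept k * extra 2 k
  kept-pointwise k with sieved? k | base? k
  ... | yes _ | yes _ = ≤-trans (*-monoʳ-≤ k (∸-monoʳ-≤ k (removed≤2 k))) (≤-trans (≤-reflexive (sym (*-identityʳ _))) (*-monoʳ-≤ (k * (k ∸ removed M k)) (extra≥1 2 (s≤s z≤n) k)))
  ... | yes (pk , inj₁ k∣n) | no ¬b = contradiction (pk , k∣n) ¬b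
  ... | yes (pk , inj₂ e) | no _ rewrite removed-∣ (extra∣M e) = begin
    k * 1 ≡⟨ *-identityʳ k ⟩
    k ≤⟨ double-pred pk ⟩
    (k ∸ 1) * 2 ≤⟨ *-monoʳ-≤ (k ∸ 1) (extra≥ 2 (s≤s z≤n) k e) ⟩
    (k ∸ 1) * extra 2 k ≡⟨ cong (_* extra 2 k) (sym (*-identityˡ (k ∸ 1))) ⟩
    1 * (k ∸ 1) * extra 2 k ∎
    where open ≤-Reasoning
  ... | no ¬s | yes (pk , k∣n) = contradiction (pk , inj₁ k∣n) ¬s
  ... | no _ | no _ = ≤-trans (extra≥1 2 (s≤s z≤n) k) (≤-reflexive (sym (*-identityˡ _)))

  errors-pointwise : ∀ k → S.modulus k * S.errors k * R k ≤ T k * S.kept k * extra 4 k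
  errors-pointwise k with sieved? k | base? k
  ... | yes _ | yes _ = begin
    k * suc (removed M k) * (k ∸ 2) ≤⟨ *-mono-≤ (≤-trans (*-monoʳ-≤ k (s≤s (removed≤2 k))) (≤-reflexive (*-comm k 3))) (∸-monoʳ-≤ k (removed≤2 k)) ⟩
    3 * k * (k ∸ removed M k) ≡⟨ sym (*-identityʳ _) ⟩
    3 * k * (k ∸ removed M k) * 1 ≤⟨ *-monoʳ-≤ (3 * k * (k ∸ removed M k)) (extra≥1 4 (s≤s z≤n) k) ⟩
    3 * k * (k ∸ removed M k) * extra 4 k ∎
    where open ≤-Reasoning
  ... | yes (pk , inj₁ k∣n) | no ¬b = contradiction (pk , k∣n) ¬b
  ... | yes (pk , inj₂ e) | no _ rewrite removed-∣ (extra∣M e) = begin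
    k * 2 * 1 ≡⟨ *-identityʳ (k * 2) ⟩
    k * 2 ≤⟨ *-monoˡ-≤ 2 (double-pred pk) ⟩
    (k ∸ 1) * 2 * 2 ≡⟨ *-assoc (k ∸ 1) 2 2 ⟩
    (k ∸ 1) * 4 ≤⟨ *-monoʳ-≤ (k ∸ 1) (extra≥ 4 (s≤s z≤n) k e) ⟩
    (k ∸ 1) * extra 4 k ≡⟨ cong (_* extra 4 k) (sym (*-identityˡ (k ∸ 1))) ⟩
    1 * (k ∸ 1) * extra 4 k ∎
    where open ≤-Reasoning
  ... | no ¬s | yes (pk , k∣n) = contradiction (pk , inj₁ k∣n) ¬s
  ... | no _ | no _ = ≤-trans (extra≥1 4 (s≤s z≤n) k) (≤-reflexive (sym (*-identityˡ _)))

  private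
    product-R≢0 : ∀ B → NonZero (product< R B)
    product-R≢0 B = >-nonZero (product<-≥1 R B R≥1)

  modulus-bound : ∀ B → 60 * product< S.modulus B ≤ 8 * m * product< S.kept B
  modulus-bound B = *-cancelʳ-≤ _ _ r {{product-R≢0 B}} (begin
    60 * w * r ≡⟨ *-assoc 60 w r ⟩
    60 * (w * r) ≤⟨ *-monoʳ-≤ 60 (begin
      w * r ≡⟨ sym (product<-* S.modulus R B) ⟩
      product< (λ k → S.modulus k * R k) B ≤⟨ product<-mono _ _ B (λ k _ → kept-pointwise k) ⟩
      product< (λ k → P k * S.kept k * extra 2 k) B ≡⟨ trans (product<-* (λ k → P k * S.kept k) (extra 2) B) (cong (_* product< (extra 2) B) (product<-* P S.kept B)) ⟩
      p * κ * product< (extra 2) B ≤⟨ *-monoʳ-≤ (p * κ) (product-extra 2 (s≤s z≤n) B) ⟩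
      p * κ * 8 ∎) ⟩
    60 * (p * κ * 8) ≡⟨ e₁ 60 p κ 8 ⟩
    60 * p * (8 * κ) ≤⟨ *-monoˡ-≤ (8 * κ) (base-bound B) ⟩
    m * r * (8 * κ) ≡⟨ e₂ m r 8 κ ⟩
    8 * m * κ * r ∎)
    where
    open ≤-Reasoning
    w = product< S.modulus B
    r = product< R B
    p = product< P B
    κ = product< S.kept B
    e₁ : ∀ a p κ b → a * (p * κ * b) ≡ a * p * (b * κ)
    e₁ = solve-∀
    e₂ : ∀ m r b κ → m * r * (b * κ) ≡ b * m * κ * r
    e₂ = solve-∀

  errors-bound : ∀ B → product< S.modulus B * product< S.errors B ≤ 64 * (m * m) * product< S.kept B
  errors-bound B = *-cancelʳ-≤ _ _ r {{product-R≢0 B}} (begin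
    w * ε * r ≡⟨ sym (trans (product<-* (λ k → S.modulus k * S.errors k) R B) (cong (_* r) (product<-* S.modulus S.errors B))) ⟩
    product< (λ k → S.modulus k * S.errors k * R k) B ≤⟨ product<-mono _ _ B (λ k _ → errors-pointwise k) ⟩
    product< (λ k → T k * S.kept k * extra 4 k) B ≡⟨ trans (product<-* (λ k → T k * S.kept k) (extra 4) B) (cong (_* product< (extra 4) B) (product<-* T S.kept B)) ⟩
    t * κ * product< (extra 4) B ≤⟨ *-mono-≤ (*-monoˡ-≤ κ (triple-bound B)) (product-extra 4 (s≤s z≤n) B) ⟩
    m * m * r * κ * 64 ≡⟨ e (m * m) r κ 64 ⟩
    64 * (m * m) * κ * r ∎)
    where
    open ≤-Reasoning
    w = product< S.modulus B
    ε = product< S.errors B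
    r = product< R B
    t = product< T B
    κ = product< S.kept B
    e : ∀ k r κ b → k * r * κ * b ≡ b * k * κ * r
    e = solve-∀

  kept-positive : ∀ B → 0 < product< S.kept B
  kept-positive B = n≢0⇒n>0 λ e → <⇒≱ (*-mono-≤ (s≤s (z≤n {59})) (positive B))
    (subst (60 * product< S.modulus B ≤_) (trans (cong (8 * m *_) e) (*-zeroʳ (8 * m))) (modulus-bound B))
    where
    positive : ∀ B → 1 ≤ product< S.modulus B
    positive B = product<-≥1 S.modulus B modulus≥1
      where
      modulus≥1 : ∀ k → 1 ≤ S.modulus k
      modulus≥1 k with sieved? k
      ... | yes (pk , _) = <⇒≤ (nonTrivial⇒n>1 k {{prime⇒nonTrivial pk}})
      ... | no _ = ≤-refl

  -- The budget in units of κ m, where κ is the kept product: the main term gives 60 m M. The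
  -- excluded points cost 8 · 3 · 2 M (m + 3) = 48 m M + 144 M and the sieve error at most 60 · 64 ·
  -- 4 M = 15360 M. The remaining 12 m M exceeds 15504 M.
  sieve-beats : m * m * m ≤ 4 * M → ∀ b c → c * (m * m) ≤ 3 * (2 * M * (m + 3)) → c < count (S.sift b) M
  sieve-beats m³≤4M b c sparse = ≰⇒> λ C≤c → <⇒≱ total< (*-cancelʳ-≤ (60 * m * M) _ (κ * m) {{κm≢0}} (begin
    60 * m * M * (κ * m) ≡⟨ e₁ m M κ ⟩
    60 * (m * m) * (M * κ) ≤⟨ *-monoʳ-≤ (60 * (m * m)) (begin
      M * κ ≤⟨ proj₂ (S.density-sift b 0 1 M (λ (d∣1 , _) → ∣1⇒≡1 d∣1)) ⟩
      w * count (progression (S.sift b) 0 1) M + S.discrepancy b * w ≤⟨ +-mono-≤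
        (*-monoʳ-≤ w (≤-trans (≤-reflexive (count-cong M λ h _ → cong (S.sift b) (*-identityˡ h))) C≤c))
        (≤-trans (≤-reflexive (*-comm (S.discrepancy b) w)) (*-monoʳ-≤ w (≤-trans (n≤1+n _) (≤-reflexive (S.suc-discrepancy b))))) ⟩
      w * c + w * product< S.errors b ≤⟨ +-monoʳ-≤ (w * c) (errors-bound b) ⟩
      w * c + 64 * (m * m) * κ ∎) ⟩
    60 * (m * m) * (w * c + 64 * (m * m) * κ) ≡⟨ e₂ m w c κ ⟩
    60 * w * (c * (m * m)) + 60 * 64 * (m * m * m) * (κ * m) ≤⟨ +-mono-≤ (*-mono-≤ (modulus-bound b) sparse) (*-monoˡ-≤ (κ * m) (*-monoʳ-≤ (60 * 64) m³≤4M)) ⟩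
    8 * m * κ * (3 * (2 * M * (m + 3))) + 60 * 64 * (4 * M) * (κ * m) ≡⟨ e₃ m κ M ⟩
    (M * (48 * m) + M * 15504) * (κ * m) ∎))
    where
    open ≤-Reasoning
    w = product< S.modulus b
    κ = product< S.kept b
    0<m : 0 < m
    0<m = ≤-trans (s≤s z≤n) 2604≤m
    κm≢0 : NonZero (κ * m)
    κm≢0 = >-nonZero (*-mono-< (kept-positive b) 0<m)
    M≢0 : NonZero M
    M≢0 = ≢-nonZero λ { refl → <⇒≱ (*-mono-< (*-mono-< 0<m 0<m) 0<m) m³≤4M }
    e₁ : ∀ m M κ → 60 * m * M * (κ * m) ≡ 60 * (m * m) * (M * κ)
    e₁ = solve-∀
    e₂ : ∀ m w c κ → 60 * (m * m) * (w * c + 64 * (m * m) * κ) ≡ 60 * w * (c * (m * m)) + 60 * 64 * (m * m * m) * (κ * m)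
    e₂ = solve-∀
    e₃ : ∀ m κ M → 8 * m * κ * (3 * (2 * M * (m + 3))) + 60 * 64 * (4 * M) * (κ * m) ≡ (M * (48 * m) + M * 15504) * (κ * m)
    e₃ = solve-∀
    total< : M * (48 * m) + M * 15504 < 60 * m * M
    total< = begin-strict
      M * (48 * m) + M * 15504 <⟨ +-monoʳ-< (M * (48 * m)) (*-monoʳ-< M {{M≢0}} (<-≤-trans (≤ᵇ⇒≤ 15505 (12 * 2604) tt) (*-monoʳ-≤ 12 2604≤m))) ⟩
      M * (48 * m) + M * (12 * m) ≡⟨ e₄ M m ⟩
      60 * m * M ∎
      where
      e₄ : ∀ M m → M * (48 * m) + M * (12 * m) ≡ 60 * m * M
      e₄ = solve-∀

  good-exists : m * m * m ≤ 4 * M → ∀ (B₁ B₂ B₃ : ℕ → Bool) → ∀ {β} → β ≡ 2 * M * (m + 3) →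
    count B₁ M * (m * m) ≤ β → count B₂ M * (m * m) ≤ β → count B₃ M * (m * m) ≤ β → ∀ b →
    ∃ λ g → g < M × S.sift b g ≡ true × B₁ g ≡ false × B₂ g ≡ false × B₃ g ≡ false
  good-exists m³≤4M B₁ B₂ B₃ {β} refl s₁ s₂ s₃ b with anyUpTo? (λ g → good g Bool≟ true) M
    where
    good : ℕ → Bool
    good g = S.sift b g ∧ (not (B₁ g) ∧ (not (B₂ g) ∧ not (B₃ g)))
  ... | yes (g , g<M , p) = let p₀ , p' = ∧-elim {S.sift b g} p ; p₁ , p'' = ∧-elim {not (B₁ g)} p' ; p₂ , p₃ = ∧-elim {not (B₂ g)} p'' in
          g , g<M , p₀ , not-true p₁ , not-true p₂ , not-true p₃
    where
    not-true : ∀ {a} → not a ≡ true → a ≡ false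
    not-true {false} _ = refl
  ... | no none = contradiction covered (<⇒≱ (sieve-beats m³≤4M b (count B₁ M + (count B₂ M + count B₃ M))
          (subst₂ _≤_ (e₁ (count B₁ M) (count B₂ M) (count B₃ M) (m * m)) (e₂ β) (+-mono-≤ s₁ (+-mono-≤ s₂ s₃)))))
    where
    e₁ : ∀ a b c k → a * k + (b * k + c * k) ≡ (a + (b + c)) * k
    e₁ = solve-∀
    e₂ : ∀ β → β + (β + β) ≡ 3 * β
    e₂ = solve-∀
    B₂₃ : ℕ → Bool
    B₂₃ g = B₂ g ∨ B₃ g
    covered : count (S.sift b) M ≤ count B₁ M + (count B₂ M + count B₃ M)
    covered = ≤-trans (count-∨ {ψ = B₁} {χ = B₂₃} M λ g g<M p → cover g g<M p)
                      (+-monoʳ-≤ (count B₁ M) (count-∨ {ψ = B₂} {χ = B₃} M λ g _ p → ∨-elim p))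
      where
      ∨-elim : ∀ {a b} → a ∨ b ≡ true → a ≡ true ⊎ b ≡ true
      ∨-elim {true}  _ = inj₁ refl
      ∨-elim {false} p = inj₂ p
      cover : ∀ g → g < M → S.sift b g ≡ true → B₁ g ≡ true ⊎ B₂₃ g ≡ true
      cover g g<M p = case (B₁ g) (B₂ g) (B₃ g) refl refl refl
        where
        case : ∀ x y z → B₁ g ≡ x → B₂ g ≡ y → B₃ g ≡ z → B₁ g ≡ true ⊎ B₂₃ g ≡ true
        case true  _     _     e₁ _  _  = inj₁ e₁
        case false true  _     _  e₂ _  = inj₂ (cong (_∨ B₃ g) e₂)
        case false false true  _  e₂ e₃ = inj₂ (trans (cong (_∨ B₃ g) e₂) e₃)
        case false false false e₁ e₂ e₃ = contradiction (g , g<M , ∧-intro p (∧-intro (cong not e₁) (∧-intro (cong not e₂) (cong not e₃)))) none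

-- The reflection g ↦ M − g

module Reflection (n m M : ℕ) .{{_ : NonZero n}} (2∤n : ¬ 2 ∣ n) (3∤n : ¬ 3 ∣ n) (2604≤m : 2604 ≤ m)
  (m⁴≤n : m * m * (m * m) ≤ n) (n≤2m⁴ : n ≤ 2 * (m * m * (m * m)))
  (2M≤m³ : 2 * M ≤ m * m * m) (m³≤4M : m * m * m ≤ 4 * M) where
  open Mod n
  open Difference n
  private
    2≤m : 2 ≤ m
    2≤m = ≤-trans (s≤s (s≤s z≤n)) 2604≤m
    module I = Inside n m M 2≤m m⁴≤n n≤2m⁴ 2M≤m³

    0<m : 0 < m
    0<m = ≤-trans (s≤s z≤n) 2604≤m

    0<M : 0 < M
    0<M = n≢0⇒n>0 λ { refl → <⇒≱ (*-mono-< (*-mono-< 0<m 0<m) 0<m) m³≤4M }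

    2M<n : 2 * M < n
    2M<n = ≤-<-trans 2M≤m³ (<-≤-trans (*-monoʳ-< (m * m) {{>-nonZero (*-mono-< 0<m 0<m)}} (m<m*n m m {{>-nonZero 0<m}} 2≤m)) m⁴≤n)

    M<n : M < n
    M<n = ≤-<-trans (m≤n*m M 2) 2M<n

  -- One shape for both outcomes of `inside-sparse`. With a sparse set, q is 1, which is not prime,
  -- so the condition on q is vacuous; with an exceptional prime, `bad` is empty.
  record Control (c : ℕ) : Set where
    field
      bad : ℕ → Bool
      sparse : count bad M * (m * m) ≤ 2 * M * (m + 3)
      q : ℕ
      q∣M : q ∣ M
      outside : ∀ g → g < M → Coprime g n → (Prime q → ¬ q ∣ g) → bad g ≡ false → (M * c) % n ≤ (g * c) % n

  control : ∀ c → Coprime c n → ¬ (c ≋ 1) → (M * c) % n ≤ M → Control c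
  control c cc c≢1 Y≤M = from (I.inside-sparse c cc c≢1 Y≤M)
    where
    inside-false : ∀ g → Coprime g n → I.inside c g ≡ false → (M * c) % n ≤ (g * c) % n
    inside-false g cg p = ≮⇒≥ λ lt → contradiction (trans (sym p) (∧-intro (dec-true (coprime? g n) cg) (dec-true ((g * c) % n <? (M * c) % n) lt))) λ ()
    from : I.Sparse (I.inside c) ⊎ (∃ λ q → Prime q × q ∣ M × (∀ g → g < M → I.inside c g ≡ true → q ∣ g)) → Control c
    from (inj₁ sp) = record { bad = I.inside c ; sparse = sp ; q = 1 ; q∣M = 1∣ M ; outside = λ g _ cg _ p → inside-false g cg p }
    from (inj₂ (q , pq , q∣M , h)) = record { bad = λ _ → false ; sparse = I.sparse-none {λ _ → false} (λ _ _ ()) ; q = q ; q∣M = q∣M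
      ; outside = λ g g<M cg q∤g _ → ≮⇒≥ λ lt → q∤g pq (h g g<M (∧-intro (dec-true (coprime? g n) cg) (dec-true ((g * c) % n <? (M * c) % n) lt))) }

  -- The signed number y = P − N satisfies M b ≡ y and ∣y∣ ≤ M; the residues of g b and (M − g) b add up to y + (1 − e) n.
  record Reflected (b P N : ℕ) : Set where
    field
      e : ℕ
      bad : ℕ → Bool
      sparse : count bad M * (m * m) ≤ 2 * M * (m + 3)
      q : ℕ
      q∣M : q ∣ M
      residues : ∀ g → g < M → Coprime g n → Coprime (M ∸ g) n → (Prime q → ¬ q ∣ g) → bad g ≡ false →
        (g * b) % n + ((M ∸ g) * b) % n + N + e * n ≡ P + n

  private
    residue-sum : ∀ b {g} → g < M → (g * b) % n + ((M ∸ g) * b) % n ≋ M * b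
    residue-sum b {g} g<M = trans (+-cong-≋ (%-≋ (g * b)) (%-≋ ((M ∸ g) * b)))
      (cong (_% n) (trans (sym (*-distribʳ-+ b g (M ∸ g))) (cong (_* b) (m+[n∸m]≡n (<⇒≤ g<M)))))

    1<n : 1 < n
    1<n = ≤-<-trans (s≤s (z≤n {0})) (≤-<-trans 0<M M<n)

  -- For y ≥ 0 the residue of g b is already at least P, so the sum of the two residues exceeds P
  -- and `wrap` leaves P + n. For y ≤ 0 the same control is applied to -b. The assumption b ≢ -1
  -- makes -b ≢ 1, as `control` demands; on the diagonal every residue g stays below M.
  reflect : ∀ b P N → Coprime b n → ¬ (b + 1 ≋ 0) → M * b + N ≋ P → (N ≡ 0 × P ≤ M) ⊎ (P ≡ 0 × N ≤ M) → Reflected b P N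
  reflect b P N cb b≢-1 cong-M sgn with b % n ≟ 1 % n
  ... | yes b≋1 = record { e = 1 ; bad = λ _ → false ; sparse = I.sparse-none {λ _ → false} (λ _ _ ()) ; q = 1 ; q∣M = 1∣ M
                         ; residues = λ g g<M _ _ _ _ → cong₂ _+_ (diagonal sgn g g<M) (+-identityʳ n) }
    where
    M+N≋P : M + N ≋ P
    M+N≋P = trans (+-cong-≋ (trans (cong (_% n) (sym (*-identityʳ M))) (*-cong-≋ (refl {x = M % n}) (sym b≋1))) (refl {x = N % n})) cong-M
    same : ∀ u → u < n → (u * b) % n ≡ u
    same u u<n = trans (*-cong-≋ (refl {x = u % n}) b≋1) (trans (cong (_% n) (*-identityʳ u)) (m<n⇒m%n≡m u<n))
    diagonal : (N ≡ 0 × P ≤ M) ⊎ (P ≡ 0 × N ≤ M) → ∀ g → g < M → (g * b) % n + ((M ∸ g) * b) % n + N ≡ P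
    diagonal (inj₁ (refl , P≤M)) g g<M = begin
      (g * b) % n + ((M ∸ g) * b) % n + 0 ≡⟨ +-identityʳ _ ⟩
      (g * b) % n + ((M ∸ g) * b) % n ≡⟨ cong₂ _+_ (same g (<-trans g<M M<n)) (same (M ∸ g) (≤-<-trans (m∸n≤m M g) M<n)) ⟩
      g + (M ∸ g) ≡⟨ m+[n∸m]≡n (<⇒≤ g<M) ⟩
      M ≡⟨ <⇒≡ M<n (≤-<-trans P≤M M<n) (trans (cong (_% n) (sym (+-identityʳ M))) M+N≋P) ⟩
      P ∎
      where open ≡-Reasoning
    -- b ≡ 1 with y ≤ 0 would make M + N divisible by n, although 0 < M + N ≤ 2 M < n.
    diagonal (inj₂ (refl , N≤M)) g g<M = contradiction (m+n≡0⇒m≡0 M (<⇒≡ (≤-<-trans (+-monoʳ-≤ M N≤M) (subst (_< n) (cong (M +_) (+-identityʳ M)) 2M<n)) (<-trans z<s 1<n) M+N≋P)) (≢-sym (<⇒≢ 0<M))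
  reflect b P N cb b≢-1 cong-M (inj₁ (refl , P≤M)) | no b≢1 = record { e = 0 ; bad = bad ; sparse = sparse ; q = q ; q∣M = q∣M
      ; residues = λ g g<M cg cg' q∤g ok → trans (+-identityʳ _) (trans (+-identityʳ _) (positive g g<M cg cg' (outside g g<M cg q∤g ok))) }
    where
    P<n = ≤-<-trans P≤M M<n
    Mb≋P : M * b ≋ P
    Mb≋P = trans (cong (_% n) (sym (+-identityʳ (M * b)))) cong-M
    Mb≡P : (M * b) % n ≡ P
    Mb≡P = <⇒%≡ P<n Mb≋P
    open Control (control b cb b≢1 (subst (_≤ M) (sym Mb≡P) P≤M))
    positive : ∀ g → g < M → Coprime g n → Coprime (M ∸ g) n → (M * b) % n ≤ (g * b) % n → (g * b) % n + ((M ∸ g) * b) % n ≡ P + n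
    positive g g<M cg cg' le = wrap (trans (residue-sum b g<M) Mb≋P)
      (≤-<-trans (subst (_≤ (g * b) % n) Mb≡P le) (m<m+n _ (residue>0 1<n (coprime-* cg' cb))))
      (+-mono-< (m%n<n (g * b) n) (m%n<n ((M ∸ g) * b) n)) P<n
  reflect b P N cb b≢-1 cong-M (inj₂ (refl , N≤M)) | no b≢1 = record { e = 0 ; bad = bad ; sparse = sparse ; q = q ; q∣M = q∣M
      ; residues = λ g g<M cg cg' q∤g ok → trans (+-identityʳ _) (negative g g<M cg cg' (outside g g<M cg q∤g ok)) }
    where
    N<n = ≤-<-trans N≤M M<n
    c = neg b
    c≢1 : ¬ (c ≋ 1)
    c≢1 c≋1 = b≢-1 (trans (+-cong-≋ (refl {x = b % n}) (sym c≋1)) (+-neg b))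
    multiple : ∀ u → u * b + u * c ≋ 0
    multiple u = trans (cong (_% n) (sym (*-distribˡ-+ u b c))) (trans (*-cong-≋ (refl {x = u % n}) (+-neg b)) (cong (_% n) (*-zeroʳ u)))
    Mc≡N : (M * c) % n ≡ N
    Mc≡N = <⇒%≡ N<n (+-cancelʳ-≋ (M * b) (trans (cong (_% n) (+-comm (M * c) (M * b))) (trans (multiple M)
             (trans (sym cong-M) (cong (_% n) (+-comm (M * b) N))))))
    open Control (control c (coprime-neg cb) c≢1 (subst (_≤ M) (sym Mc≡N) N≤M))
    negative : ∀ g → g < M → Coprime g n → Coprime (M ∸ g) n → (M * c) % n ≤ (g * c) % n → (g * b) % n + ((M ∸ g) * b) % n + N ≡ n
    negative g g<M cg cg' le = wrap (trans (+-cong-≋ (residue-sum b g<M) (refl {x = N % n})) cong-M)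
        (<-≤-trans (residue>0 1<n (coprime-* cg cb)) (≤-trans (m≤m+n X X') (m≤m+n (X + X') N)))
        (subst (_< n + n) (lem X N X') (+-mono-≤-< (≤-trans (+-monoʳ-≤ X (subst (_≤ Z) Mc≡N le)) (≤-reflexive X+Z)) (m%n<n ((M ∸ g) * b) n)))
        (<-trans z<s 1<n)
      where
      X = (g * b) % n
      X' = ((M ∸ g) * b) % n
      Z = (g * c) % n
      lem : ∀ x n x' → x + n + x' ≡ x + x' + n
      lem = solve-∀
      X+Z : X + Z ≡ n
      X+Z = wrap (trans (+-cong-≋ (%-≋ (g * b)) (%-≋ (g * c))) (multiple g))
              (<-≤-trans (residue>0 1<n (coprime-* cg cb)) (m≤m+n X Z)) (+-mono-< (m%n<n (g * b) n) (m%n<n (g * c) n)) (<-trans z<s 1<n)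

  coprime-by-primes : ∀ a → (∀ p → Prime p → p ∣ n → ¬ p ∣ a) → Coprime a n
  coprime-by-primes a h {d} (d∣a , d∣n) with d ≟ 1
  ... | yes d≡1 = d≡1
  ... | no d≢1 = let p , pp , p∣d = primeDivisor d {{d≢0}} d≢1 in contradiction (∣-trans p∣d d∣a) (h p pp (∣-trans p∣d d∣n))
    where
    d≢0 : NonZero d
    d≢0 = ≢-nonZero λ { refl → ≢-nonZero⁻¹ n (0∣⇒≡0 d∣n) }

  unbalanced : ∀ b₁ b₂ b₃ {P₁ P₂ P₃ N₁ N₂ N₃} → Reflected b₁ P₁ N₁ → Reflected b₂ P₂ N₂ → Reflected b₃ P₃ N₃ →
    M + (P₁ + P₂ + P₃) ≡ N₁ + N₂ + N₃ →
    ¬ (∀ g → Coprime g n → g % n + (g * b₁) % n + (g * b₂) % n + (g * b₃) % n ≡ 2 * n)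
  unbalanced b₁ b₂ b₃ {P₁} {P₂} {P₃} {N₁} {N₂} {N₃} r₁ r₂ r₃ ΣP≡ΣN H = contradict found
    where
    module R₁ = Reflected r₁
    module R₂ = Reflected r₂
    module R₃ = Reflected r₃
    module Pr = Products n m M 2∤n 3∤n 2604≤m n≤2m⁴ R₁.q R₂.q R₃.q R₁.q∣M R₂.q∣M R₃.q∣M
    -- Large enough to pass every prime divisor of n and of M.
    B = suc (n + M)
    found = Pr.good-exists m³≤4M R₁.bad R₂.bad R₃.bad refl R₁.sparse R₂.sparse R₃.sparse B
    contradict : (∃ λ g → g < M × Pr.S.sift B g ≡ true × R₁.bad g ≡ false × R₂.bad g ≡ false × R₃.bad g ≡ false) → ⊥
    contradict (g , g<M , sifted , ok₁ , ok₂ , ok₃) = <-irrefl (sym total) (m<m+n (3 * n) (<-≤-trans (<-trans z<s 1<n) (m≤m+n n _)))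
      where
      avoided : ∀ k → Prime k → (k ∣ n ⊎ Pr.Extra k) → k ≤ n + M → ¬ k ∣ g × ¬ k ∣ ∣ g - M ∣
      avoided k pk e k≤ = Pr.S.sift-avoids B k g (s≤s k≤) (dec-true (Pr.sieved? k) (pk , e)) sifted
      ≤n+M : ∀ {k} → k ∣ n → k ≤ n + M
      ≤n+M d = ≤-trans (∣⇒≤ d) (m≤m+n n M)
      cg : Coprime g n
      cg = coprime-by-primes g λ p pp p∣n → proj₁ (avoided p pp (inj₁ p∣n) (≤n+M p∣n))
      cg' : Coprime (M ∸ g) n
      cg' = coprime-by-primes (M ∸ g) λ p pp p∣n → subst (λ x → ¬ p ∣ x) (m≤n⇒∣m-n∣≡n∸m (<⇒≤ g<M)) (proj₂ (avoided p pp (inj₁ p∣n) (≤n+M p∣n)))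
      extra : ∀ q → Pr.Extra q → Prime q → ¬ q ∣ g
      extra q e pq = proj₁ (avoided q pq (inj₂ e) (≤-trans (∣⇒≤ {{>-nonZero 0<M}} (Pr.extra∣M e)) (m≤n+m M n)))
      x x' : ℕ → ℕ
      x b = (g * b) % n
      x' b = ((M ∸ g) * b) % n
      s₁ = R₁.residues g g<M cg cg' (extra R₁.q (inj₁ refl)) ok₁
      s₂ = R₂.residues g g<M cg cg' (extra R₂.q (inj₂ (inj₁ refl))) ok₂
      s₃ = R₃.residues g g<M cg cg' (extra R₃.q (inj₂ (inj₂ refl))) ok₃
      h : g + x b₁ + x b₂ + x b₃ ≡ 2 * n
      h = trans (cong (λ u → u + x b₁ + x b₂ + x b₃) (sym (m<n⇒m%n≡m (<-trans g<M M<n)))) (H g cg)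
      h' : (M ∸ g) + x' b₁ + x' b₂ + x' b₃ ≡ 2 * n
      h' = trans (cong (λ u → u + x' b₁ + x' b₂ + x' b₃) (sym (m<n⇒m%n≡m (≤-<-trans (m∸n≤m M g) M<n)))) (H (M ∸ g) cg')
      ΣN = N₁ + N₂ + N₃
      Σe = R₁.e + R₂.e + R₃.e
      total : 3 * n + (n + Σe * n) ≡ 3 * n
      total = +-cancelˡ-≡ ΣN _ _ (begin
        ΣN + (3 * n + (n + Σe * n)) ≡⟨ e₁ ΣN n (Σe * n) ⟩
        (2 * n + 2 * n) + ΣN + Σe * n ≡⟨ cong (λ u → u + ΣN + Σe * n) (cong₂ _+_ (sym h) (sym h')) ⟩
        (g + x b₁ + x b₂ + x b₃ + (M ∸ g + x' b₁ + x' b₂ + x' b₃)) + ΣN + Σe * n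
          ≡⟨ e₂ g (M ∸ g) (x b₁) (x b₂) (x b₃) (x' b₁) (x' b₂) (x' b₃) N₁ N₂ N₃ R₁.e R₂.e R₃.e n ⟩
        (g + (M ∸ g)) + ((x b₁ + x' b₁ + N₁ + R₁.e * n) + (x b₂ + x' b₂ + N₂ + R₂.e * n) + (x b₃ + x' b₃ + N₃ + R₃.e * n))
          ≡⟨ cong₂ _+_ (m+[n∸m]≡n (<⇒≤ g<M)) (cong₂ _+_ (cong₂ _+_ s₁ s₂) s₃) ⟩
        M + ((P₁ + n) + (P₂ + n) + (P₃ + n)) ≡⟨ e₃ M P₁ P₂ P₃ n ⟩
        M + (P₁ + P₂ + P₃) + 3 * n ≡⟨ cong (_+ 3 * n) ΣP≡ΣN ⟩
        ΣN + 3 * n ∎)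
        where
        open ≡-Reasoning
        e₁ : ∀ s n e → s + (3 * n + (n + e)) ≡ (2 * n + 2 * n) + s + e
        e₁ = solve-∀
        e₂ : ∀ g g' a b c a' b' c' u v w e f h n → (g + a + b + c + (g' + a' + b' + c')) + (u + v + w) + (e + f + h) * n
             ≡ (g + g') + ((a + a' + u + e * n) + (b + b' + v + f * n) + (c + c' + w + h * n))
        e₂ = solve-∀
        e₃ : ∀ M a b c n → M + ((a + n) + (b + n) + (c + n)) ≡ M + (a + b + c) + 3 * n
        e₃ = solve-∀

-- Small relations

∸-swap : ∀ a b → (a ∸ b) + b ≡ (b ∸ a) + a
∸-swap zero    b       rewrite 0∸n≡0 b = sym (+-identityʳ b)
∸-swap (suc a) zero    = +-identityʳ (suc a)
∸-swap (suc a) (suc b) = trans (+-suc (a ∸ b) b) (trans (cong suc (∸-swap a b)) (sym (+-suc (b ∸ a) a)))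

∸-signed : ∀ a b → b ∸ a ≡ 0 ⊎ a ∸ b ≡ 0
∸-signed a b with ≤-total a b
... | inj₁ a≤b = inj₂ (m≤n⇒m∸n≡0 a≤b)
... | inj₂ b≤a = inj₁ (m≤n⇒m∸n≡0 b≤a)

∸-size : ∀ a b → (a ∸ b) + (b ∸ a) ≡ ∣ a - b ∣
∸-size zero b rewrite 0∸n≡0 b = refl
∸-size (suc a) zero = +-identityʳ (suc a)
∸-size (suc a) (suc b) = ∸-size a b

module Descent (n m : ℕ) .{{_ : NonZero n}} (2∤n : ¬ 2 ∣ n) (3∤n : ¬ 3 ∣ n) (2604≤m : 2604 ≤ m)
  (m⁴≤n : m * m * (m * m) ≤ n) (n≤2m⁴ : n ≤ 2 * (m * m * (m * m))) where
  open Mod n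
  open Difference n

  Sum2n : ℕ → ℕ → ℕ → ℕ → Set
  Sum2n a b c d = ∀ g → Coprime g n → (g * a) % n + (g * b) % n + (g * c) % n + (g * d) % n ≡ 2 * n

  -- D a is congruent to the signed number pos − neg.
  record Entry (D a : ℕ) : Set where
    field
      pos ngt : ℕ
      congruent : D * a + ngt ≋ pos
      signed : ngt ≡ 0 ⊎ pos ≡ 0
    size : ℕ
    size = pos + ngt

  open Entry

  private
    -- The factor 12 serves two ends: (12 m)³ = 1728 m³ < m⁴ leaves fewer cells than multipliers,
    -- and n ≤ 2 m⁴ gives X ≤ m³ / 6, so that even an entry of size 3 X is at most m³ / 2.
    k : ℕ
    k = 12 * m
    0<m : 0 < m
    0<m = ≤-trans (s≤s z≤n) 2604≤m
    instance
      m≢0 : NonZero m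
      m≢0 = >-nonZero 0<m
      k≢0 : NonZero k
      k≢0 = m*n≢0 12 m
    X = n / k

    6X≤m³ : 6 * X ≤ m * m * m
    6X≤m³ = *-cancelˡ-≤ (2 * m) {{m*n≢0 2 m}} (begin
      2 * m * (6 * X) ≡⟨ e₁ m X ⟩
      X * k ≤⟨ m/n*n≤m n k ⟩
      n ≤⟨ n≤2m⁴ ⟩
      2 * (m * m * (m * m)) ≡⟨ e₂ m ⟩
      2 * m * (m * m * m) ∎)
      where
      open ≤-Reasoning
      e₁ : ∀ m X → 2 * m * (6 * X) ≡ X * (12 * m)
      e₁ = solve-∀
      e₂ : ∀ m → 2 * (m * m * (m * m)) ≡ 2 * m * (m * m * m)
      e₂ = solve-∀

    k³<n : k * (k * k) < n
    k³<n = begin-strict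
      k * (k * k) ≡⟨ e₁ m ⟩
      1728 * (m * m * m) <⟨ *-monoˡ-< (m * m * m) {{m*n≢0 (m * m) m {{m*n≢0 m m}}}} (<-≤-trans (≤ᵇ⇒≤ 1729 2604 tt) 2604≤m) ⟩
      m * (m * m * m) ≡⟨ e₂ m ⟩
      m * m * (m * m) ≤⟨ m⁴≤n ⟩
      n ∎
      where
      open ≤-Reasoning
      e₁ : ∀ m → 12 * m * (12 * m * (12 * m)) ≡ 1728 * (m * m * m)
      e₁ = solve-∀
      e₂ : ∀ m → m * (m * m * m) ≡ m * m * (m * m)
      e₂ = solve-∀

  reduce : ∀ {D a} P N → D * a + N ≋ P → Entry D a
  reduce {D} {a} P N h = record { pos = P ∸ N ; ngt = N ∸ P ; signed = ∸-signed P N ; congruent = +-cancelʳ-≋ P (begin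
    (D * a + (N ∸ P) + P) % n ≡⟨ cong (_% n) (trans (+-assoc (D * a) (N ∸ P) P) (trans (cong (D * a +_) (∸-swap N P)) (e (D * a) (P ∸ N) N))) ⟩
    (P ∸ N + (D * a + N)) % n ≡⟨ +-cong-≋ (refl {x = (P ∸ N) % n}) h ⟩
    (P ∸ N + P) % n ∎) }
    where
    open ≡-Reasoning
    e : ∀ d p x → d + (p + x) ≡ p + (d + x)
    e = solve-∀

  flip : ∀ {D a} → Entry D a → Entry (neg D) a
  flip {D} {a} e = record { pos = ngt e ; ngt = pos e ; signed = swap (signed e) ; congruent = begin
    (neg D * a + pos e) % n ≡⟨ +-cong-≋ (refl {x = (neg D * a) % n}) (sym (congruent e)) ⟩
    (neg D * a + (D * a + ngt e)) % n ≡⟨ cong (_% n) (lem (neg D) D a (ngt e)) ⟩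
    ((D + neg D) * a + ngt e) % n ≡⟨ +-cong-≋ (*-cong-≋ (+-neg D) (refl {x = a % n})) (refl {x = ngt e % n}) ⟩
    ngt e % n ∎ }
    where
    open ≡-Reasoning
    lem : ∀ d' d a x → d' * a + (d * a + x) ≡ (d + d') * a + x
    lem = solve-∀
    swap : ∀ {A B : Set} → A ⊎ B → B ⊎ A
    swap (inj₁ x) = inj₂ x
    swap (inj₂ y) = inj₁ y

  difference : ∀ a {u v} → u ≤ v → (v ∸ u) * a + (u * a) % n ≋ (v * a) % n
  difference a {u} {v} u≤v = trans (+-cong-≋ (refl {x = ((v ∸ u) * a) % n}) (%-≋ (u * a)))
    (trans (cong (_% n) (trans (sym (*-distribʳ-+ a (v ∸ u) u)) (cong (_* a) (m∸n+n≡m u≤v)))) (sym (%-≋ (v * a))))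

  record Relation (a b c : ℕ) : Set where
    field
      D : ℕ
      D≢0 : ¬ D ≋ 0
      ea : Entry D a
      eb : Entry D b
      ec : Entry D c
      sa : size ea ≤ X
      sb : size eb ≤ X
      sc : size ec ≤ X

  -- Pigeonhole for the multipliers below n in a cube of k³ cells. Three coordinates suffice because
  -- the zero sum will supply the fourth.
  relation : ∀ a b c → Relation a b c
  relation a b c = from-collision (pigeonhole k³<n λ i → combine (cell a i) (combine (cell b i) (cell c i)))
    where
    z : ℕ → ℕ → ℕ
    z a u = (u * a) % n
    z/L<k : ∀ a u → z a u / suc X < k
    z/L<k a u = cell< (m%n<n (u * a) n)
    cell : ℕ → Fin n → Fin k
    cell a i = fromℕ< (z/L<k a (toℕ i))
    from-collision : (∃ λ i → ∃ λ j → toℕ i < toℕ j × combine (cell a i) (combine (cell b i) (cell c i)) ≡ combine (cell a j) (combine (cell b j) (cell c j))) → Relation a b c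
    from-collision (i , j , i<j , eq) = record
      { D = v ∸ u
      ; D≢0 = λ D≋0 → <⇒≢ (m<n⇒0<n∸m i<j) (sym (<⇒≡ (≤-<-trans (m∸n≤m v u) (toℕ<n j)) (≤-<-trans z≤n (toℕ<n j)) D≋0))
      ; ea = entry a ; eb = entry b ; ec = entry c
      ; sa = entry-size a (proj₁ inj) ; sb = entry-size b (proj₁ inj') ; sc = entry-size c (proj₂ inj') }
      where
      u = toℕ i
      v = toℕ j
      inj = combine-injective (cell a i) _ (cell a j) _ eq
      inj' = combine-injective (cell b i) (cell c i) (cell b j) (cell c j) (proj₂ inj)
      entry : ∀ a → Entry (v ∸ u) a
      entry a = reduce (z a v) (z a u) (difference a (<⇒≤ i<j))
      entry-size : ∀ a → cell a i ≡ cell a j → size (entry a) ≤ X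
      entry-size a e = subst (_≤ X) (sym (∸-size (z a v) (z a u))) (s≤s⁻¹ (quotient-≡⇒dist< (z a v) (z a u) (suc X)
        (trans (sym (toℕ-fromℕ< (z/L<k a v))) (trans (cong toℕ (sym e)) (toℕ-fromℕ< (z/L<k a u))))))

  Balanced : ∀ {D a b c d} → Entry D a → Entry D b → Entry D c → Entry D d → Set
  Balanced ea eb ec ed = pos ea + (pos eb + pos ec + pos ed) ≡ ngt ea + (ngt eb + ngt ec + ngt ed)

  -- Dividing the sequence by a makes its first term 1 and turns the hypothesis for g into that for
  -- g u, with u the inverse of a. Then M₀ u ≡ D, so the entries for b u, c u, d u under the
  -- multiplier M = t M₀ are t times the old ones.
  maximal-positive : ∀ {D a b c d} (ea : Entry D a) (eb : Entry D b) (ec : Entry D c) (ed : Entry D d) → ¬ D ≋ 0 →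
    Coprime a n → Coprime b n → Coprime c n → Coprime d n → ¬ (b + a ≋ 0) → ¬ (c + a ≋ 0) → ¬ (d + a ≋ 0) →
    size eb ≤ size ea → size ec ≤ size ea → size ed ≤ size ea → size ea ≤ 3 * X → ngt ea ≡ 0 →
    Balanced ea eb ec ed → ¬ Sum2n a b c d
  maximal-positive {D} {a} {b} {c} {d} ea eb ec ed D≢0 ca cb cc cd b+a c+a d+a sb sc sd sa na bal H =
    R.unbalanced (b * u) (c * u) (d * u) (reflected eb cb b+a sb) (reflected ec cc c+a sc) (reflected ed cd d+a sd) balance
      λ g cg → trans (cong₂ _+_ (cong₂ _+_ (cong₂ _+_ (scale-a g) (scale g b)) (scale g c)) (scale g d)) (H (g * u) (coprime-* cg cu))
    where
    M₀ = pos ea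
    size≡ : size ea ≡ M₀
    size≡ = trans (cong (M₀ +_) na) (+-identityʳ M₀)
    M₀>0 : 0 < M₀
    M₀>0 = n≢0⇒n>0 λ M₀≡0 → D≢0 (*-cancelʳ-≋ ca (trans (cong (_% n) (sym (trans (cong (D * a +_) na) (+-identityʳ _)))) (trans (congruent ea) (cong (_% n) M₀≡0))))
    2M₀≤m³ : 2 * M₀ ≤ m * m * m
    2M₀≤m³ = ≤-trans (*-monoʳ-≤ 2 (subst (_≤ 3 * X) size≡ sa)) (≤-trans (≤-reflexive (sym (*-assoc 2 3 X))) 6X≤m³)
    instance
      2M₀≢0 : NonZero (2 * M₀)
      2M₀≢0 = m*n≢0 2 M₀ {{_}} {{>-nonZero M₀>0}}
    -- The largest t with 2 t M₀ ≤ m³. Since t ≥ 1, rounding down loses at most a factor 2, hence m³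
    -- ≤ 4 M.
    t = m * m * m / (2 * M₀)
    M = t * M₀
    2M≤m³ : 2 * M ≤ m * m * m
    2M≤m³ = ≤-trans (≤-reflexive (e t M₀)) (m/n*n≤m (m * m * m) (2 * M₀))
      where
      e : ∀ t M → 2 * (t * M) ≡ t * (2 * M)
      e = solve-∀
    m³≤4M : m * m * m ≤ 4 * M
    m³≤4M = begin
      m * m * m ≡⟨ m≡m%n+[m/n]*n (m * m * m) (2 * M₀) ⟩
      (m * m * m) % (2 * M₀) + t * (2 * M₀) ≤⟨ +-monoˡ-≤ (t * (2 * M₀)) (<⇒≤ (m%n<n (m * m * m) (2 * M₀))) ⟩
      2 * M₀ + t * (2 * M₀) ≤⟨ +-monoˡ-≤ (t * (2 * M₀)) (≤-trans (≤-reflexive (sym (*-identityˡ _))) (*-monoˡ-≤ (2 * M₀) (m≥n⇒m/n>0 2M₀≤m³))) ⟩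
      t * (2 * M₀) + t * (2 * M₀) ≡⟨ e t M₀ ⟩
      4 * M ∎
      where
      open ≤-Reasoning
      e : ∀ t M → t * (2 * M) + t * (2 * M) ≡ 4 * (t * M)
      e = solve-∀
    module R = Reflection n m M 2∤n 3∤n 2604≤m m⁴≤n n≤2m⁴ 2M≤m³ m³≤4M
    u = proj₁ (inverse ca)
    ua≋1 : u * a ≋ 1
    ua≋1 = proj₂ (inverse ca)
    cu : Coprime u n
    cu = coprime-inverse ua≋1
    M₀u≋D : M₀ * u ≋ D
    M₀u≋D = begin
      (M₀ * u) % n ≡⟨ *-cong-≋ (sym (congruent ea)) (refl {x = u % n}) ⟩
      ((D * a + ngt ea) * u) % n ≡⟨ cong (λ x → ((D * a + x) * u) % n) na ⟩
      ((D * a + 0) * u) % n ≡⟨ cong (_% n) (e D a u) ⟩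
      (D * (u * a)) % n ≡⟨ *-cong-≋ (refl {x = D % n}) ua≋1 ⟩
      (D * 1) % n ≡⟨ cong (_% n) (*-identityʳ D) ⟩
      D % n ∎
      where
      open ≡-Reasoning
      e : ∀ D a u → (D * a + 0) * u ≡ D * (u * a)
      e = solve-∀
    reflected : ∀ {b} (eb : Entry D b) → Coprime b n → ¬ (b + a ≋ 0) → size eb ≤ size ea → R.Reflected (b * u) (t * pos eb) (t * ngt eb)
    reflected {b} eb cb b+a sb = R.reflect (b * u) (t * pos eb) (t * ngt eb) (coprime-* cb cu)
        (λ h → b+a (begin
          (b + a) % n ≡⟨ cong (_% n) (cong (_+ a) (sym (*-identityʳ b))) ⟩
          (b * 1 + a) % n ≡⟨ +-cong-≋ (*-cong-≋ (refl {x = b % n}) (sym ua≋1)) (refl {x = a % n}) ⟩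
          (b * (u * a) + a) % n ≡⟨ cong (_% n) (e₁ b u a) ⟩
          ((b * u + 1) * a) % n ≡⟨ *-cong-≋ h (refl {x = a % n}) ⟩
          0 % n ∎))
        (begin
          (M * (b * u) + t * ngt eb) % n ≡⟨ cong (_% n) (e₂ t M₀ b u (ngt eb)) ⟩
          (t * (M₀ * u * b + ngt eb)) % n ≡⟨ *-cong-≋ (refl {x = t % n}) (trans (+-cong-≋ (*-cong-≋ M₀u≋D (refl {x = b % n})) (refl {x = ngt eb % n})) (congruent eb)) ⟩
          (t * pos eb) % n ∎)
        (sgn (signed eb))
      where
      open ≡-Reasoning
      e₁ : ∀ b u a → b * (u * a) + a ≡ (b * u + 1) * a
      e₁ = solve-∀
      e₂ : ∀ t M b u x → t * M * (b * u) + t * x ≡ t * (M * u * b + x)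
      e₂ = solve-∀
      sb' : pos eb + ngt eb ≤ M₀
      sb' = subst (size eb ≤_) size≡ sb
      sgn : ngt eb ≡ 0 ⊎ pos eb ≡ 0 → (t * ngt eb ≡ 0 × t * pos eb ≤ M) ⊎ (t * pos eb ≡ 0 × t * ngt eb ≤ M)
      sgn (inj₁ e) = inj₁ (trans (cong (t *_) e) (*-zeroʳ t) , *-monoʳ-≤ t (≤-trans (m≤m+n _ _) sb'))
      sgn (inj₂ e) = inj₂ (trans (cong (t *_) e) (*-zeroʳ t) , *-monoʳ-≤ t (≤-trans (m≤n+m _ _) sb'))
    balance : M + (t * pos eb + t * pos ec + t * pos ed) ≡ t * ngt eb + t * ngt ec + t * ngt ed
    balance = begin
      M + (t * pos eb + t * pos ec + t * pos ed) ≡⟨ e₁ t M₀ (pos eb) (pos ec) (pos ed) ⟩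
      t * (M₀ + (pos eb + pos ec + pos ed)) ≡⟨ cong (t *_) (trans bal (cong (_+ (ngt eb + ngt ec + ngt ed)) na)) ⟩
      t * (ngt eb + ngt ec + ngt ed) ≡⟨ e₂ t (ngt eb) (ngt ec) (ngt ed) ⟩
      t * ngt eb + t * ngt ec + t * ngt ed ∎
      where
      open ≡-Reasoning
      e₁ : ∀ t M a b c → t * M + (t * a + t * b + t * c) ≡ t * (M + (a + b + c))
      e₁ = solve-∀
      e₂ : ∀ t a b c → t * (a + b + c) ≡ t * a + t * b + t * c
      e₂ = solve-∀
    scale-a : ∀ g → g % n ≡ (g * u * a) % n
    scale-a g = trans (cong (_% n) (sym (*-identityʳ g))) (trans (*-cong-≋ (refl {x = g % n}) (sym ua≋1)) (cong (_% n) (sym (*-assoc g u a))))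
    scale : ∀ g b → (g * (b * u)) % n ≡ (g * u * b) % n
    scale g b = cong (_% n) (e g b u)
      where
      e : ∀ g b u → g * (b * u) ≡ g * u * b
      e = solve-∀

  maximal : ∀ {D a b c d} (ea : Entry D a) (eb : Entry D b) (ec : Entry D c) (ed : Entry D d) → ¬ D ≋ 0 →
    Coprime a n → Coprime b n → Coprime c n → Coprime d n → ¬ (b + a ≋ 0) → ¬ (c + a ≋ 0) → ¬ (d + a ≋ 0) →
    size eb ≤ size ea → size ec ≤ size ea → size ed ≤ size ea → size ea ≤ 3 * X →
    Balanced ea eb ec ed → ¬ Sum2n a b c d
  maximal {D} ea eb ec ed D≢0 ca cb cc cd b+a c+a d+a sb sc sd sa bal = by-sign (signed ea)
    where
    D'≢0 : ¬ neg D ≋ 0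
    D'≢0 h = D≢0 (trans (cong (_% n) (sym (+-identityʳ D))) (trans (+-cong-≋ (refl {x = D % n}) (sym h)) (+-neg D)))
    by-sign : ngt ea ≡ 0 ⊎ pos ea ≡ 0 → _
    by-sign (inj₁ na) = maximal-positive ea eb ec ed D≢0 ca cb cc cd b+a c+a d+a sb sc sd sa na bal
    by-sign (inj₂ pa) = maximal-positive (flip ea) (flip eb) (flip ec) (flip ed) D'≢0 ca cb cc cd b+a c+a d+a
      (both eb sb) (both ec sc) (both ed sd) (subst (_≤ 3 * X) (+-comm (pos ea) (ngt ea)) sa) pa (sym bal)
      where
      both : ∀ {b} (eb : Entry D b) → size eb ≤ size ea → size (flip eb) ≤ size (flip ea)
      both eb = subst₂ _≤_ (+-comm (pos eb) (ngt eb)) (+-comm (pos ea) (ngt ea))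

  -- The fourth entry is defined as minus the sum of the other three, so the four numbers add up to
  -- 0 exactly, and not merely modulo n. The rest puts an entry of largest size first.
  no-relation : ∀ a b c d → Relation a b c → Coprime a n → Coprime b n → Coprime c n → Coprime d n → a + b + c + d ≋ 0 →
    ¬ (b + a ≋ 0) → ¬ (c + a ≋ 0) → ¬ (d + a ≋ 0) → ¬ (c + b ≋ 0) → ¬ (d + b ≋ 0) → ¬ (d + c ≋ 0) → ¬ Sum2n a b c d
  no-relation a b c d rel ca cb cc cd Σ≋0 b+a c+a d+a c+b d+b d+c H = choose (≤-total (size eb) (size ea)) (≤-total (size ed) (size ec))
    where
    open Relation rel
    P = pos ea + pos eb + pos ec
    N = ngt ea + ngt eb + ngt ec
    ed : Entry D d
    ed = reduce N P (+-cancelʳ-≋ N (begin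
      (D * d + P + N) % n ≡⟨ cong (_% n) (+-assoc (D * d) P N) ⟩
      (D * d + (P + N)) % n ≡⟨ +-cong-≋ (refl {x = (D * d) % n}) (+-cong-≋ (sym (+-cong-≋ (+-cong-≋ (congruent ea) (congruent eb)) (congruent ec))) (refl {x = N % n})) ⟩
      (D * d + (D * a + ngt ea + (D * b + ngt eb) + (D * c + ngt ec) + N)) % n ≡⟨ cong (_% n) (e₁ D a b c d (ngt ea) (ngt eb) (ngt ec)) ⟩
      (D * (a + b + c + d) + (N + N)) % n ≡⟨ +-cong-≋ (trans (*-cong-≋ (refl {x = D % n}) Σ≋0) (cong (_% n) (*-zeroʳ D))) (refl {x = (N + N) % n}) ⟩
      (N + N) % n ∎))
      where
      open ≡-Reasoning
      e₁ : ∀ D a b c d x y z → D * d + (D * a + x + (D * b + y) + (D * c + z) + (x + y + z)) ≡ D * (a + b + c + d) + ((x + y + z) + (x + y + z))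
      e₁ = solve-∀
    bal : Balanced ea eb ec ed
    bal = trans (e (pos ea) (pos eb) (pos ec) (N ∸ P)) (trans (∸-swap N P) (sym (e (ngt ea) (ngt eb) (ngt ec) (P ∸ N))))
      where
      e : ∀ a b c d → a + (b + c + d) ≡ d + (a + b + c)
      e = solve-∀
    X≤3X : X ≤ 3 * X
    X≤3X = m≤n*m X 3
    sd : size ed ≤ 3 * X
    sd = begin
      size ed ≡⟨ ∸-size N P ⟩
      ∣ N - P ∣ ≤⟨ ∣m-n∣≤m⊔n N P ⟩
      N ⊔ P ≤⟨ ⊔-lub (m≤n+m N P) (m≤m+n P N) ⟩
      P + N ≡⟨ e (pos ea) (pos eb) (pos ec) (ngt ea) (ngt eb) (ngt ec) ⟩
      size ea + (size eb + (size ec + 0)) ≤⟨ +-mono-≤ sa (+-mono-≤ sb (+-monoˡ-≤ 0 sc)) ⟩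
      3 * X ∎
      where
      open ≤-Reasoning
      e : ∀ a b c x y z → (a + b + c) + (x + y + z) ≡ a + x + (b + y + (c + z + 0))
      e = solve-∀
    sym+ : ∀ x y → ¬ (x + y ≋ 0) → ¬ (y + x ≋ 0)
    sym+ x y h e = h (trans (cong (_% n) (+-comm x y)) e)
    permuted : (f : ℕ → ℕ → ℕ → ℕ → ℕ) → (∀ x₀ x₁ x₂ x₃ → f x₀ x₁ x₂ x₃ ≡ x₀ + (x₁ + x₂ + x₃)) →
      f (pos ea) (pos eb) (pos ec) (pos ed) ≡ f (ngt ea) (ngt eb) (ngt ec) (ngt ed)
    permuted f h = trans (h (pos ea) (pos eb) (pos ec) (pos ed)) (trans bal (sym (h (ngt ea) (ngt eb) (ngt ec) (ngt ed))))
    first : size eb ≤ size ea → size ec ≤ size ea → size ed ≤ size ea → ⊥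
    first u v w = maximal ea eb ec ed D≢0 ca cb cc cd b+a c+a d+a u v w (≤-trans sa X≤3X) bal H
    second : size ea ≤ size eb → size ec ≤ size eb → size ed ≤ size eb → ⊥
    second u v w = maximal eb ea ec ed D≢0 cb ca cc cd (sym+ b a b+a) c+b d+b u v w (≤-trans sb X≤3X)
      (permuted (λ x₀ x₁ x₂ x₃ → x₁ + (x₀ + x₂ + x₃)) p) λ g cg → trans (p' ((g * a) % n) ((g * b) % n) ((g * c) % n) ((g * d) % n)) (H g cg)
      where
      p : ∀ x₀ x₁ x₂ x₃ → x₁ + (x₀ + x₂ + x₃) ≡ x₀ + (x₁ + x₂ + x₃)
      p = solve-∀
      p' : ∀ x₀ x₁ x₂ x₃ → x₁ + x₀ + x₂ + x₃ ≡ x₀ + x₁ + x₂ + x₃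
      p' = solve-∀
    third : size ea ≤ size ec → size eb ≤ size ec → size ed ≤ size ec → ⊥
    third u v w = maximal ec ea eb ed D≢0 cc ca cb cd (sym+ c a c+a) (sym+ c b c+b) d+c u v w (≤-trans sc X≤3X)
      (permuted (λ x₀ x₁ x₂ x₃ → x₂ + (x₀ + x₁ + x₃)) p) λ g cg → trans (p' ((g * a) % n) ((g * b) % n) ((g * c) % n) ((g * d) % n)) (H g cg)
      where
      p : ∀ x₀ x₁ x₂ x₃ → x₂ + (x₀ + x₁ + x₃) ≡ x₀ + (x₁ + x₂ + x₃)
      p = solve-∀
      p' : ∀ x₀ x₁ x₂ x₃ → x₂ + x₀ + x₁ + x₃ ≡ x₀ + x₁ + x₂ + x₃
      p' = solve-∀
    fourth : size ea ≤ size ed → size eb ≤ size ed → size ec ≤ size ed → ⊥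
    fourth u v w = maximal ed ea eb ec D≢0 cd ca cb cc (sym+ d a d+a) (sym+ d b d+b) (sym+ d c d+c) u v w sd
      (permuted (λ x₀ x₁ x₂ x₃ → x₃ + (x₀ + x₁ + x₂)) p) λ g cg → trans (p' ((g * a) % n) ((g * b) % n) ((g * c) % n) ((g * d) % n)) (H g cg)
      where
      p : ∀ x₀ x₁ x₂ x₃ → x₃ + (x₀ + x₁ + x₂) ≡ x₀ + (x₁ + x₂ + x₃)
      p = solve-∀
      p' : ∀ x₀ x₁ x₂ x₃ → x₃ + x₀ + x₁ + x₂ ≡ x₀ + x₁ + x₂ + x₃
      p' = solve-∀
    choose : size eb ≤ size ea ⊎ size ea ≤ size eb → size ed ≤ size ec ⊎ size ec ≤ size ed → ⊥
    choose (inj₁ b≤a) (inj₁ d≤c) with ≤-total (size ec) (size ea)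
    ... | inj₁ c≤a = first b≤a c≤a (≤-trans d≤c c≤a)
    ... | inj₂ a≤c = third a≤c (≤-trans b≤a a≤c) d≤c
    choose (inj₁ b≤a) (inj₂ c≤d) with ≤-total (size ed) (size ea)
    ... | inj₁ d≤a = first b≤a (≤-trans c≤d d≤a) d≤a
    ... | inj₂ a≤d = fourth a≤d (≤-trans b≤a a≤d) c≤d
    choose (inj₂ a≤b) (inj₁ d≤c) with ≤-total (size ec) (size eb)
    ... | inj₁ c≤b = second a≤b c≤b (≤-trans d≤c c≤b)
    ... | inj₂ b≤c = third (≤-trans a≤b b≤c) b≤c d≤c
    choose (inj₂ a≤b) (inj₂ c≤d) with ≤-total (size ed) (size eb)
    ... | inj₁ d≤b = second a≤b (≤-trans c≤d d≤b) d≤b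
    ... | inj₂ b≤d = fourth (≤-trans a≤b b≤d) b≤d c≤d

  impossible : ∀ a b c d → Coprime a n → Coprime b n → Coprime c n → Coprime d n → a + b + c + d ≋ 0 →
    ¬ (b + a ≋ 0) → ¬ (c + a ≋ 0) → ¬ (d + a ≋ 0) → ¬ (c + b ≋ 0) → ¬ (d + b ≋ 0) → ¬ (d + c ≋ 0) → ¬ Sum2n a b c d
  impossible a b c d = no-relation a b c d (relation a b c)

-- The index

fourthRoot : ∀ n → ∃ λ m → m * m * (m * m) ≤ n × n < suc m * suc m * (suc m * suc m)
fourthRoot zero = 0 , z≤n , s≤s z≤n
fourthRoot (suc n) with fourthRoot n
... | m , lo , hi with suc m * suc m * (suc m * suc m) ≤? suc n
...   | yes le = suc m , le , ≤-<-trans hi (*-mono-< (*-mono-< (n<1+n (suc m)) (n<1+n (suc m))) (*-mono-< (n<1+n (suc m)) (n<1+n (suc m))))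
...   | no ≰ = m , m≤n⇒m≤1+n lo , ≰⇒> ≰

foldr-⊓-lower : ∀ {x y} ys → x ≤ y → (∀ z → z ∈ ys → x ≤ z) → x ≤ foldr _⊓_ y ys
foldr-⊓-lower [] x≤y h = x≤y
foldr-⊓-lower (z ∷ ys) x≤y h = ⊓-glb (h z (here refl)) (foldr-⊓-lower ys x≤y λ w w∈ → h w (there w∈))

foldr-⊓-≤ : ∀ {x y} ys → x ∈ y ∷ ys → foldr _⊓_ y ys ≤ x
foldr-⊓-≤ [] (here refl) = ≤-refl
foldr-⊓-≤ (z ∷ ys) (here refl) = ≤-trans (m⊓n≤n z _) (foldr-⊓-≤ ys (here refl))
foldr-⊓-≤ {y = y} (z ∷ ys) (there (here refl)) = m⊓n≤m z _
foldr-⊓-≤ (z ∷ ys) (there (there x∈)) = ≤-trans (m⊓n≤n z _) (foldr-⊓-≤ ys (there x∈))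

minimumℕ-attained : ∀ {x d} xs → x ∈ xs → (∀ y → y ∈ xs → x ≤ y) → minimumℕ d xs ≡ x
minimumℕ-attained (y ∷ ys) x∈ h = ≤-antisym (foldr-⊓-≤ ys x∈) (foldr-⊓-lower ys (h y (here refl)) λ z z∈ → h z (there z∈))

∈-units : ∀ n {g} → 0 < g → g < n → gcd g n ≡ 1 → g ∈ units n
∈-units (suc n) {suc g} _ (s≤s g<n) e = ∈-filter⁺ (λ g → gcd g (suc n) ≟ 1) (∈-applyUpTo⁺ suc g<n) e

n/n≃1 : ∀ n .{{_ : NonZero n}} → (ℤ.+ n) ℚᵘ./ n ≃ 1ℚᵘ
n/n≃1 (suc n) = *≡* (trans (ℤ.*-identityʳ (ℤ.+ suc n)) (sym (ℤ.*-identityˡ (ℤ.+ suc n))))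

module Index (n : ℕ) .{{_ : NonZero n}} (1<n : 1 < n) (a b c d : ℕ)
  (ca : Coprime a n) (cb : Coprime b n) (cc : Coprime c n) (cd : Coprime d n) where
  open Mod n
  open Difference n

  total : ℕ → ℕ
  total g = (g * a) % n + ((g * b) % n + ((g * c) % n + ((g * d) % n + 0)))

  module _ (Σ≋0 : a + (b + (c + (d + 0))) ≋ 0) where
    total≋0 : ∀ g → total g ≋ 0
    total≋0 g = begin
      total g % n ≡⟨ +-cong-≋ (%-≋ (g * a)) (+-cong-≋ (%-≋ (g * b)) (+-cong-≋ (%-≋ (g * c)) (+-cong-≋ (%-≋ (g * d)) (refl {x = 0 % n})))) ⟩
      (g * a + (g * b + (g * c + (g * d + 0)))) % n ≡⟨ cong (_% n) (e g a b c d) ⟩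
      (g * (a + (b + (c + (d + 0))))) % n ≡⟨ *-cong-≋ (refl {x = g % n}) Σ≋0 ⟩
      (g * 0) % n ≡⟨ cong (_% n) (*-zeroʳ g) ⟩
      0 % n ∎
      where
      open ≡-Reasoning
      e : ∀ g a b c d → g * a + (g * b + (g * c + (g * d + 0))) ≡ g * (a + (b + (c + (d + 0))))
      e = solve-∀

    total>0 : ∀ {g} → Coprime g n → 0 < total g
    total>0 {g} cg = <-≤-trans (residue>0 1<n (coprime-* cg ca)) (m≤m+n _ _)

    n≤total : ∀ {g} → Coprime g n → n ≤ total g
    n≤total {g} cg = ∣⇒≤ {{>-nonZero (total>0 cg)}} (≋0⇒∣ (total≋0 g))

    opposite : ∀ {u} g → Coprime u n → Coprime g n → (g * u) % n + (neg g * u) % n ≡ n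
    opposite {u} g cu cg = wrap (trans (+-cong-≋ (%-≋ (g * u)) (%-≋ (neg g * u))) (trans (cong (_% n) (sym (*-distribʳ-+ u g (neg g))))
        (*-cong-≋ (+-neg g) (refl {x = u % n})))) (<-≤-trans (residue>0 1<n (coprime-* cg cu)) (m≤m+n _ _))
        (+-mono-< (m%n<n (g * u) n) (m%n<n (neg g * u) n)) (<-trans z<s 1<n)

    total-opposite : ∀ {g} → Coprime g n → total g + total (neg g) ≡ 4 * n
    total-opposite {g} cg = trans (e ((g * a) % n) ((g * b) % n) ((g * c) % n) ((g * d) % n) ((neg g * a) % n) ((neg g * b) % n) ((neg g * c) % n) ((neg g * d) % n))
      (cong₂ _+_ (opposite g ca cg) (cong₂ _+_ (opposite g cb cg) (cong₂ _+_ (opposite g cc cg) (cong (_+ 0) (opposite g cd cg)))))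
      where
      e : ∀ a b c d a' b' c' d' → a + (b + (c + (d + 0))) + (a' + (b' + (c' + (d' + 0)))) ≡ (a + a') + ((b + b') + ((c + c') + ((d + d') + 0)))
      e = solve-∀

    total-% : ∀ g → total (g % n) ≡ total g
    total-% g = cong₂ _+_ (r a) (cong₂ _+_ (r b) (cong₂ _+_ (r c) (cong (_+ 0) (r d))))
      where
      r : ∀ u → (g % n * u) % n ≡ (g * u) % n
      r u = *-cong-≋ (%-≋ g) (refl {x = u % n})

    -- The totals of g and -g add up to 4 n. A total of 3 n or more would therefore force the total
    -- n for -g.
    total-2n : (∀ g → Coprime g n → total g ≢ n) → ∀ g → Coprime g n → total g ≡ 2 * n
    total-2n h g cg = quotient-2 (≋0⇒∣ (total≋0 g))
      where
      quotient-2 : n ∣ total g → total g ≡ 2 * n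
      quotient-2 (divides 0 e) = contradiction e (≢-sym (<⇒≢ (total>0 cg)))
      quotient-2 (divides 1 e) = contradiction (trans e (+-identityʳ n)) (h g cg)
      quotient-2 (divides 2 e) = e
      quotient-2 (divides (suc (suc (suc q))) e) = contradiction (≤-antisym upper (n≤total (coprime-neg cg))) (h (neg g) (coprime-neg cg))
        where
        upper : total (neg g) ≤ n
        upper = +-cancelˡ-≤ (3 * n) _ _ (begin
          3 * n + total (neg g) ≤⟨ +-monoˡ-≤ (total (neg g)) (≤-trans (*-monoˡ-≤ n (m≤m+n 3 q)) (≤-reflexive (sym e))) ⟩
          total g + total (neg g) ≡⟨ total-opposite cg ⟩
          4 * n ≡⟨ +-comm n (3 * n) ⟩
          3 * n + n ∎)
          where open ≤-Reasoning

    unit-with-total-n : ¬ (∀ g → Coprime g n → total g ≡ 2 * n) → ∃ λ g → 0 < g × g < n × Coprime g n × total g ≡ n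
    unit-with-total-n h with anyUpTo? (λ g → coprime? g n ×-dec (total g ≟ n)) n
    ... | yes (g , g<n , cg , e) = g , subst (0 <_) (m<n⇒m%n≡m g<n) (residue>0 1<n cg) , g<n , cg , e
    -- The finite search below n speaks for every g because the total depends only on g modulo n; so
    -- a witness is obtained from a negated statement.
    ... | no none = contradiction (total-2n λ g cg e → none (g % n , m%n<n g n , coprime-≋ (sym (%-≋ g)) cg , trans (total-% g) e)) h

theorem1p4 : (n : ℕ) .{{_ : NonZero n}} → 46000000000000 < n → gcd n 6 ≡ 1 →
    (S : Seq 4) → IsSeqOver n 4 S → IsMinimalZeroSum n 4 S →
    ((i : Fin 4) → gcd n (S i) ≡ 1) →
    ind n 4 S ≃ 1ℚᵘ
theorem1p4 n n-large n6 S S<n (zeroSum , minimal) coprime-S =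
  subst (λ k → (ℤ.+ k) ℚᵘ./ n ≃ 1ℚᵘ) (sym nInd≡n) (n/n≃1 n)
  where
  open Mod n
  a = S zero
  b = S (suc zero)
  c = S (suc (suc zero))
  d = S (suc (suc (suc zero)))
  cop : ∀ i → Coprime (S i) n
  cop i = Coprimality.sym (gcd≡1⇒coprime (coprime-S i))
  1<n : 1 < n
  1<n = <-trans (≤ᵇ⇒≤ 2 46000000000000 tt) n-large
  open Index n 1<n a b c d (cop zero) (cop (suc zero)) (cop (suc (suc zero))) (cop (suc (suc (suc zero))))
  Σ≋0 : a + (b + (c + (d + 0))) ≋ 0
  Σ≋0 = trans zeroSum (sym 0%n≡0)
  2∤n : ¬ 2 ∣ n
  2∤n h = contradiction (∣1⇒≡1 (subst (2 ∣_) n6 (gcd-greatest h (divides 3 refl)))) λ ()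
  3∤n : ¬ 3 ∣ n
  3∤n h = contradiction (∣1⇒≡1 (subst (3 ∣_) n6 (gcd-greatest h (divides 2 refl)))) λ ()
  pair : ∀ x y {s} → s ≡ x + y → ¬ ZeroSumMod n s → ¬ (y + x ≋ 0)
  pair x y refl h e = h (trans (cong (_% n) (+-comm x y)) (trans e 0%n≡0))
  m = proj₁ (fourthRoot n)
  m⁴≤n : m * m * (m * m) ≤ n
  m⁴≤n = proj₁ (proj₂ (fourthRoot n))
  n<[1+m]⁴ : n < suc m * suc m * (suc m * suc m)
  n<[1+m]⁴ = proj₂ (proj₂ (fourthRoot n))
  -- 2604 is the largest integer whose fourth power is at most 4.6 · 10¹³.
  2604≤m : 2604 ≤ m
  2604≤m = ≮⇒≥ λ m<2604 → <⇒≱ (<-trans n-large n<[1+m]⁴)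
    (≤-trans (*-mono-≤ (*-mono-≤ m<2604 m<2604) (*-mono-≤ m<2604 m<2604)) (≤ᵇ⇒≤ (2604 * 2604 * (2604 * 2604)) 46000000000000 tt))
  n≤2m⁴ : n ≤ 2 * (m * m * (m * m))
  -- For m ≥ 6 the ratio (m + 1) / m is at most 7 / 6, and (7 / 6)⁴ < 2.
  n≤2m⁴ = ≤-trans (<⇒≤ n<[1+m]⁴) (subst₂ _≤_ (e (suc m)) (cong (2 *_) (e m)) (power-ratio 4 6 7 2 (suc m) m
      (subst₂ _≤_ (e₁ m) (e₂ m) (+-monoʳ-≤ (6 * m) (≤-trans (≤ᵇ⇒≤ 6 2604 tt) 2604≤m))) (≤ᵇ⇒≤ (7 ^ 4) (6 ^ 4 * 2) tt)))
    where
    e : ∀ x → x * (x * (x * (x * 1))) ≡ x * x * (x * x)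
    e = solve-∀
    e₁ : ∀ m → 6 * m + 6 ≡ 6 * (1 + m)
    e₁ = solve-∀
    e₂ : ∀ m → 6 * m + m ≡ 7 * m
    e₂ = solve-∀
  not-all : ¬ (∀ g → Coprime g n → total g ≡ 2 * n)
  not-all H = Descent.impossible n m 2∤n 3∤n 2604≤m m⁴≤n n≤2m⁴ a b c d
    (cop zero) (cop (suc zero)) (cop (suc (suc zero))) (cop (suc (suc (suc zero))))
    (trans (cong (_% n) (e a b c d)) Σ≋0)
    -- Minimality is applied to the six two-term subsequences, since any of the four terms may
    -- become the one normalised to 1.
    (pair a b (e₁ a b) (minimal (λ { zero → true ; (suc zero) → true ; _ → false }) (zero , refl) (suc (suc zero) , refl)))
    (pair a c (e₁ a c) (minimal (λ { zero → true ; (suc (suc zero)) → true ; _ → false }) (zero , refl) (suc zero , refl)))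
    (pair a d (e₁ a d) (minimal (λ { zero → true ; (suc (suc (suc zero))) → true ; _ → false }) (zero , refl) (suc zero , refl)))
    (pair b c (e₁ b c) (minimal (λ { (suc zero) → true ; (suc (suc zero)) → true ; _ → false }) (suc zero , refl) (zero , refl)))
    (pair b d (e₁ b d) (minimal (λ { (suc zero) → true ; (suc (suc (suc zero))) → true ; _ → false }) (suc zero , refl) (zero , refl)))
    (pair c d (e₁ c d) (minimal (λ { (suc (suc zero)) → true ; (suc (suc (suc zero))) → true ; _ → false }) (suc (suc zero) , refl) (zero , refl)))
    λ g cg → trans (e ((g * a) % n) ((g * b) % n) ((g * c) % n) ((g * d) % n)) (H g cg)
    where
    e : ∀ a b c d → a + b + c + d ≡ a + (b + (c + (d + 0)))
    e = solve-∀
    e₁ : ∀ x y → x + (y + 0) ≡ x + y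
    e₁ = solve-∀
  attained : (∃ λ g → 0 < g × g < n × Coprime g n × total g ≡ n) → nInd n 4 S ≡ n
  attained (g , 0<g , g<n , cg , e) = minimumℕ-attained (map (λ g → multSum n 4 g S) (units n))
    (subst (_∈ map (λ g → multSum n 4 g S) (units n)) e (∈-map⁺ (λ g → multSum n 4 g S) (∈-units n 0<g g<n (coprime⇒gcd≡1 cg))))
    λ y y∈ → let h , h∈ , y≡ = ∈-map⁻ (λ g → multSum n 4 g S) y∈ in subst (n ≤_) (sym y≡)
      (n≤total Σ≋0 {h} (gcd≡1⇒coprime (proj₂ (∈-filter⁻ (λ g → gcd g n ≟ 1) {xs = drop 1 (upTo n)} h∈))))
  nInd≡n : nInd n 4 S ≡ n
  nInd≡n = attained (unit-with-total-n Σ≋0 not-all)
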